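{- Let $F$ be a face of $\mathcal P_\Phi$ of dimension $1$. Then the roots in $F$ form a string with $2$ or $3$ roots: if $\gamma$ and $\gamma'$ are the vertices of $F$, then either (1) $\gamma$ and $\gamma'$ are not perpendicular, there are no other roots in $F$, and $\gamma-\gamma'$ is a root; or (2) $\gamma$ and $\gamma'$ are perpendicular, there is only a third root $\gamma''$ in $F$ ($\gamma''$ short), and $\gamma-\gamma''=\gamma''-\gamma'$ is a root (so that $\gamma-\gamma'$ is twice a root).
   Context: $\Phi$ is a finite irreducible reduced crystallographic root system in the Euclidean space $\mathrm{Span}_{\mathbb R}\Phi$ with scalar product $(\cdot,\cdot)$; its elements are called roots. $\mathcal P_\Phi$ is the convex hull of $\Phi$. For roots $\alpha,\beta$, the $\alpha$-string through $\beta$ is $(\beta+\mathbb Z\alpha)\cap\Phi$; "the roots in $F$ form a string" means that $F\cap\Phi$ is the $\beta$-string through one of its elements, for some $\beta\in\Phi$. If $\Phi$ has roots of two different lengths, the short roots are those of smaller length; if all roots have the same length, they are all regarded as long. -}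

module Defs where

open import Algebra.Bundles using (CommutativeRing)
open import Algebra.Core using (Op₁)
open import Algebra.Module.Bundles using (Module)
import Algebra.Definitions.RawMonoid as RawMonoidDefinitions
open import Data.Fin.Base using (Fin)
open import Data.Integer.Base using (ℤ; +_; -[1+_])
open import Data.List.Base using (List; []; length)
import Data.List.Membership.Setoid as Membership
import Data.List.Relation.Unary.Unique.Setoid as Unique
open import Data.Nat.Base using (ℕ; suc)
open import Data.Product.Base using (Σ-syntax; ∃; ∃-syntax; _×_)
open import Data.Sum.Base using (_⊎_)
open import Data.Vec.Functional using (Vector)
open import Function.Bundles using (_⇔_)
open import Level using (Level; _⊔_) renaming (suc to lsuc)
open import Relation.Binary.Bundles using (Setoid)
open import Relation.Binary.Core using (Rel)
import Relation.Binary.Construct.StrictToNonStrict as StrictToNonStrict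
open import Relation.Binary.Structures using (IsStrictTotalOrder)
open import Relation.Binary.PropositionalEquality.Core using (_≡_; _≢_)
open import Relation.Nullary.Negation using (¬_)
open import Relation.Unary using (Pred; _∩_)

-- The classical real numbers, characterised (uniquely up to isomorphism) as
-- the Dedekind-complete ordered field.  `_⁻¹` is total, with an unspecified
-- value at 0#.
record RealField (c ℓ : Level) : Set (lsuc (c ⊔ ℓ)) where
  infix 4 _<_
  infix 8 _⁻¹
  field
    commutativeRing : CommutativeRing c ℓ
  open CommutativeRing commutativeRing public
  field
    _<_                : Rel Carrier ℓ
    isStrictTotalOrder : IsStrictTotalOrder _≈_ _<_
    _⁻¹                : Op₁ Carrier
    ⁻¹-inverseʳ        : ∀ x → x ≉ 0# → x * x ⁻¹ ≈ 1#
    0<1                : 0# < 1#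
    +-monoʳ-<          : ∀ z {x y} → x < y → z + x < z + y
    *-pos              : ∀ {x y} → 0# < x → 0# < y → 0# < x * y

  open StrictToNonStrict _≈_ _<_ public using (_≤_)

  UpperBound : Pred Carrier (c ⊔ ℓ) → Pred Carrier (c ⊔ ℓ)
  UpperBound S b = ∀ x → S x → x ≤ b

  field
    supremum : ∀ (S : Pred Carrier (c ⊔ ℓ)) → ∃ S → ∃ (UpperBound S) →
               ∃[ s ] (UpperBound S s × (∀ b → UpperBound S b → s ≤ b))

  open RawMonoidDefinitions +-rawMonoid public
    using () renaming (sum to ∑; _×_ to _·_)

  fromℤ : ℤ → Carrier
  fromℤ (+ n)    = n · 1#
  fromℤ -[1+ n ] = - (suc n · 1#)

-- A real vector space with a scalar product.  Finite dimensionality is not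
-- required here: it is forced once the space is spanned by a finite set.
record EuclideanSpace {c ℓ} (ℝ : RealField c ℓ) (m ℓm : Level)
       : Set (lsuc (c ⊔ ℓ ⊔ m ⊔ ℓm)) where
  open RealField ℝ
  field
    vectorSpace : Module commutativeRing m ℓm
  open Module vectorSpace public
    hiding (+ᴹ-rawMonoid; _*ᵣ_)
  open Module vectorSpace using (+ᴹ-rawMonoid)
  field
    ⟨_,_⟩         : Carrierᴹ → Carrierᴹ → Carrier
    ⟨⟩-cong       : ∀ {u u′ v v′} → u ≈ᴹ u′ → v ≈ᴹ v′ → ⟨ u , v ⟩ ≈ ⟨ u′ , v′ ⟩
    ⟨⟩-sym        : ∀ u v → ⟨ u , v ⟩ ≈ ⟨ v , u ⟩
    ⟨⟩-+ˡ         : ∀ u v w → ⟨ u +ᴹ v , w ⟩ ≈ ⟨ u , w ⟩ + ⟨ v , w ⟩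
    ⟨⟩-*ˡ         : ∀ a u v → ⟨ a *ₗ u , v ⟩ ≈ a * ⟨ u , v ⟩
    ⟨⟩-nonNeg     : ∀ v → 0# ≤ ⟨ v , v ⟩
    ⟨⟩-definite   : ∀ v → ⟨ v , v ⟩ ≈ 0# → v ≈ᴹ 0ᴹ

  open RawMonoidDefinitions +ᴹ-rawMonoid public using () renaming (sum to ∑ᴹ)

  setoidᴹ : Setoid m ℓm
  setoidᴹ = record { isEquivalence = ≈ᴹ-isEquivalence }

  infixl 6 _-ᴹ_
  _-ᴹ_ : Carrierᴹ → Carrierᴹ → Carrierᴹ
  u -ᴹ v = u +ᴹ (-ᴹ v)

  open Membership setoidᴹ public using (_∈_)
  open Unique setoidᴹ public using (Unique)

module Convexity {c ℓ m ℓm} {ℝ : RealField c ℓ} (E : EuclideanSpace ℝ m ℓm) where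
  open RealField ℝ
  open EuclideanSpace E

  linComb : ∀ {n} → Vector Carrier n → Vector Carrierᴹ n → Carrierᴹ
  linComb a p = ∑ᴹ (λ i → a i *ₗ p i)

  Span : ∀ {s} → Pred Carrierᴹ s → Pred Carrierᴹ (c ⊔ m ⊔ ℓm ⊔ s)
  Span S x = ∃[ n ] Σ[ p ∈ Vector Carrierᴹ n ] Σ[ a ∈ Vector Carrier n ]
    ((∀ i → S (p i)) × x ≈ᴹ linComb a p)

  ConvexHull : ∀ {s} → Pred Carrierᴹ s → Pred Carrierᴹ (c ⊔ ℓ ⊔ m ⊔ ℓm ⊔ s)
  ConvexHull S x = ∃[ n ] Σ[ p ∈ Vector Carrierᴹ n ] Σ[ a ∈ Vector Carrier n ]
    ((∀ i → S (p i)) × (∀ i → 0# ≤ a i) × ∑ a ≈ 1# × x ≈ᴹ linComb a p)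

  AffinelyIndependent : ∀ {n} → Vector Carrierᴹ n → Set (c ⊔ ℓ ⊔ ℓm)
  AffinelyIndependent p = ∀ a → ∑ a ≈ 0# → linComb a p ≈ᴹ 0ᴹ → ∀ i → a i ≈ 0#

  -- The affine hull of S has dimension d: it has an affine basis of d + 1
  -- points taken from S.
  HasDimension : ∀ {s} → Pred Carrierᴹ s → ℕ → Set (c ⊔ ℓ ⊔ m ⊔ ℓm ⊔ s)
  HasDimension S d = Σ[ p ∈ Vector Carrierᴹ (suc d) ]
    ((∀ i → S (p i)) × AffinelyIndependent p ×
     (∀ x → S x → Σ[ a ∈ Vector Carrier (suc d) ] (∑ a ≈ 1# × x ≈ᴹ linComb a p)))

  -- F is the intersection of P with a supporting hyperplane
  -- { x | ⟨ w , x ⟩ ≈ b }.  Since w is nonzero, a full-dimensional P is not a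
  -- face of itself.
  IsFace : ∀ {p f} → Pred Carrierᴹ p → Pred Carrierᴹ f → Set (c ⊔ ℓ ⊔ m ⊔ ℓm ⊔ p ⊔ f)
  IsFace P F = Σ[ w ∈ Carrierᴹ ] Σ[ b ∈ Carrier ]
    (w ≉ᴹ 0ᴹ ×
     (∀ x → P x → ⟨ w , x ⟩ ≤ b) ×
     (∀ x → F x ⇔ (P x × ⟨ w , x ⟩ ≈ b)))

  IsVertex : ∀ {p} → Pred Carrierᴹ p → Pred Carrierᴹ (c ⊔ ℓ ⊔ m ⊔ ℓm ⊔ p)
  IsVertex P v = IsFace P (λ x → x ≈ᴹ v)

  AreTheVertices : ∀ {p} → Pred Carrierᴹ p → Carrierᴹ → Carrierᴹ →
                   Set (c ⊔ ℓ ⊔ m ⊔ ℓm ⊔ p)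
  AreTheVertices P γ γ′ =
    γ ≉ᴹ γ′ × (∀ v → IsVertex P v ⇔ (v ≈ᴹ γ ⊎ v ≈ᴹ γ′))

  HasCardinality : ∀ {s} → Pred Carrierᴹ s → ℕ → Set (m ⊔ ℓm ⊔ s)
  HasCardinality S k = ∃[ xs ] (Unique xs × length xs ≡ k × (∀ x → S x ⇔ x ∈ xs))

-- Finite subsets are given by lists, up to order and repetition.
module RootSystems {c ℓ m ℓm} {ℝ : RealField c ℓ} (E : EuclideanSpace ℝ m ℓm) where
  open RealField ℝ
  open EuclideanSpace E
  open Convexity E

  -- 2 (β , α) / (α , α)
  cartan : Carrierᴹ → Carrierᴹ → Carrier
  cartan β α = (1# + 1#) * ⟨ β , α ⟩ * ⟨ α , α ⟩ ⁻¹

  reflect : Carrierᴹ → Carrierᴹ → Carrierᴹ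
  reflect α β = β -ᴹ cartan β α *ₗ α

  record IsRootSystem (Φ : List Carrierᴹ) : Set (c ⊔ ℓ ⊔ m ⊔ ℓm) where
    field
      spanning   : ∀ v → Span (_∈ Φ) v
      nonzero    : ∀ {α} → α ∈ Φ → α ≉ᴹ 0ᴹ
      reflection : ∀ {α β} → α ∈ Φ → β ∈ Φ → reflect α β ∈ Φ

  Crystallographic : List Carrierᴹ → Set (ℓ ⊔ m ⊔ ℓm)
  Crystallographic Φ = ∀ {α β} → α ∈ Φ → β ∈ Φ → ∃[ n ] (cartan β α ≈ fromℤ n)

  Reduced : List Carrierᴹ → Set (c ⊔ ℓ ⊔ m ⊔ ℓm)
  Reduced Φ = ∀ {α} a → α ∈ Φ → a *ₗ α ∈ Φ → a ≈ 1# ⊎ a ≈ - 1#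

  -- Φ is nonempty and not the union of two nonempty orthogonal subsets (which
  -- are then disjoint, as roots are nonzero).
  Irreducible : List Carrierᴹ → Set (ℓ ⊔ m ⊔ ℓm)
  Irreducible Φ = Φ ≢ [] ×
    ¬ (∃[ Φ₁ ] ∃[ Φ₂ ]
       (Φ₁ ≢ [] × Φ₂ ≢ [] ×
        (∀ x → x ∈ Φ ⇔ (x ∈ Φ₁ ⊎ x ∈ Φ₂)) ×
        (∀ α β → α ∈ Φ₁ → β ∈ Φ₂ → ⟨ α , β ⟩ ≈ 0#)))

  -- The roots of an irreducible system have at most two lengths, so the short
  -- ones are those admitting a strictly longer root; if all lengths agree no
  -- root is short.
  IsShort : List Carrierᴹ → Pred Carrierᴹ (ℓ ⊔ m ⊔ ℓm)
  IsShort Φ β = β ∈ Φ × ∃[ α ] (α ∈ Φ × ⟨ β , β ⟩ < ⟨ α , α ⟩)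

  rootString : List Carrierᴹ → Carrierᴹ → Carrierᴹ → Pred Carrierᴹ (m ⊔ ℓm)
  rootString Φ α β x = (∃[ n ] (x ≈ᴹ β +ᴹ fromℤ n *ₗ α)) × x ∈ Φ

  RootsFormString : ∀ {f} → List Carrierᴹ → Pred Carrierᴹ f → Set (m ⊔ ℓm ⊔ f)
  RootsFormString Φ F = ∃[ β ] ∃[ α ]
    (β ∈ Φ × (F ∩ (_∈ Φ)) α × (∀ x → (F ∩ (_∈ Φ)) x ⇔ rootString Φ β α x))

{-# OPTIONS --safe #-}

-- Let w be the functional supporting the face F, with value b on F; b > 0 since
-- Φ = -Φ spans.  The roots in F lie on a line; let g and g′ be the extreme ones.
-- Two roots of F never form an obtuse angle, as their sum would be a root of
-- height 2 b; so if x is a root strictly between g and g′, then g - x and x - g′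
-- are proportional roots, hence equal, and x is the midpoint.  If g and g′ are
-- not orthogonal, g - g′ is itself a root, so by reducedness there is no such x.
-- If they are orthogonal, irreducibility gives a root α with ⟨ α , g ⟩ and
-- ⟨ α , g′ ⟩ positive.  Reflecting α in g and then in g′ lowers its height by
-- (c + c′) b with integers c, c′ ≥ 1, and heights lie in [- b , b], so α has
-- height b: it is the third root in F.
module Submission where

open import Defs
open import Algebra.Bundles using (CommutativeRing)
import Algebra.Properties.AbelianGroup as AbelianGroupProperties
import Algebra.Properties.Ring as RingProperties
import Algebra.Properties.Semiring.Mult.TCOptimised as Multiples
import Algebra.Properties.Semiring.Sum as SemiringSum
import Algebra.Solver.Ring as RingSolver
open import Algebra.Solver.Ring.AlmostCommutativeRing
  using (fromCommutativeRing; _-Raw-AlmostCommutative⟶_)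
open import Data.Fin.Base using (Fin; zero; suc)
open import Data.Integer.Base as ℤ using (ℤ; +_; -[1+_])
import Data.Integer.Properties as ℤ
open import Data.List.Base using (List; []; _∷_; filter)
import Data.List.Extrema as Extrema
import Data.List.Membership.Setoid as SetoidMembership
import Data.List.Membership.Setoid.Properties as Membership
open Membership using (∈-filter⁺; ∈-filter⁻)
open import Data.List.Relation.Unary.All as All using ([]; _∷_)
open import Data.List.Relation.Unary.All.Properties using (all-filter)
open import Data.List.Relation.Unary.AllPairs.Core using ([]; _∷_)
open import Data.List.Relation.Unary.Any as Any using (Any; any?; here; there)
import Data.Maybe.Base as Maybe
open import Data.Nat.Base as ℕ using (zero; suc)
import Data.Nat.Properties as ℕ
open import Data.Product.Base using (∃-syntax; _×_; _,_; proj₁; proj₂)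
import Data.Sign.Base as Sign
open import Data.Sum.Base as Sum using (_⊎_; inj₁; inj₂; [_,_]′)
open import Data.Vec.Functional using (Vector)
open import Function.Base using (_∘_)
open import Function.Bundles using (_⇔_; mk⇔; Equivalence)
open import Level using (Level; _⊔_)
open import Relation.Binary.Bundles using (StrictPartialOrder; TotalOrder)
import Relation.Binary.Construct.StrictToNonStrict as StrictToNonStrict
open import Relation.Binary.Definitions using (tri<; tri≈; tri>)
open import Relation.Binary.PropositionalEquality.Core as ≡ using (_≢_)
import Relation.Binary.Reasoning.Setoid as ≈-Reasoning
import Relation.Binary.Reasoning.StrictPartialOrder as StrictPartialOrderReasoning
open import Relation.Binary.Structures using (IsStrictTotalOrder)
open import Relation.Nullary.Decidable using (Dec; yes; no; dec⇒maybe; map′; _×-dec_; ¬?)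
open import Relation.Nullary.Negation using (¬_; contradiction)
open import Relation.Unary using (Pred; _∩_)

-- A point of the hull is an average of arbitrary roots, so roots have to be brought onto `F` first.
-- The tool is the equality case of an average: at the maximal height, every root of nonzero weight
-- has that height itself. This yields roots in `F`, makes the extreme ones distinct when `F` has
-- dimension 1, and makes them vertices, supported by `g - g′` and its negative. The root `α` comes
-- from reading irreducibility as connectedness: some root is orthogonal to neither end. As the ends
-- are orthogonal, reflecting in one of them flips the sign there and leaves the pairing with the
-- other alone, so both signs can be corrected independently. For the same reason the second Cartan
-- integer stays positive after the first reflection.

-- Integer coefficients for the ring solver.

module IntegerCoefficients {r₁ r₂} (R : CommutativeRing r₁ r₂) where
  open CommutativeRing R
  open RingProperties ring
  open Multiples semiring using (×-homo-+; ×1-homo-*; 1+×) renaming (_×_ to _·_)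
  open ≈-Reasoning setoid

  -- The solver needs coefficients whose equality is decided by computation, hence integers. With
  -- the optimised multiple, `con (+ 1)` and `con (+ 2)` stand for exactly `1#` and `1# + 1#`.
  ⟦_⟧ : ℤ → Carrier
  ⟦ + n ⟧      = n · 1#
  ⟦ -[1+ n ] ⟧ = - (suc n · 1#)

  ⊖-homo : ∀ m n → ⟦ m ℤ.⊖ n ⟧ ≈ m · 1# - n · 1#
  ⊖-homo zero    zero    = sym (-‿inverseʳ 0#)
  ⊖-homo zero    (suc n) = sym (+-identityˡ _)
  ⊖-homo (suc m) zero    = sym (trans (+-congˡ -0#≈0#) (+-identityʳ _))
  ⊖-homo (suc m) (suc n) = begin
    ⟦ suc m ℤ.⊖ suc n ⟧                 ≡⟨ ≡.cong ⟦_⟧ (ℤ.[1+m]⊖[1+n]≡m⊖n m n) ⟩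
    ⟦ m ℤ.⊖ n ⟧                         ≈⟨ ⊖-homo m n ⟩
    m · 1# - n · 1#                     ≈⟨ +-congʳ (xyx⁻¹≈y 1# (m · 1#)) ⟨
    1# + m · 1# - 1# - n · 1#           ≈⟨ +-assoc _ _ _ ⟩
    1# + m · 1# + (- 1# - n · 1#)       ≈⟨ +-congˡ (-‿+-comm _ _) ⟩
    1# + m · 1# - (1# + n · 1#)         ≈⟨ +-cong (1+× m 1#) (-‿cong (1+× n 1#)) ⟨
    suc m · 1# - suc n · 1#             ∎

  +-homo : ∀ i j → ⟦ i ℤ.+ j ⟧ ≈ ⟦ i ⟧ + ⟦ j ⟧
  +-homo (+ m)    (+ n)    = ×-homo-+ 1# m n
  +-homo (+ m)    -[1+ n ] = ⊖-homo m (suc n)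
  +-homo -[1+ m ] (+ n)    = trans (⊖-homo n (suc m)) (+-comm _ _)
  +-homo -[1+ m ] -[1+ n ] = begin
    - (suc (suc (m ℕ.+ n)) · 1#)   ≡⟨ ≡.cong (λ k → - (suc k · 1#)) (ℕ.+-suc m n) ⟨
    - (suc (m ℕ.+ suc n) · 1#)     ≈⟨ -‿cong (×-homo-+ 1# (suc m) (suc n)) ⟩
    - (suc m · 1# + suc n · 1#)    ≈⟨ -‿+-comm _ _ ⟨
    - (suc m · 1#) - suc n · 1#    ∎

  +◃-homo : ∀ n → ⟦ Sign.+ ℤ.◃ n ⟧ ≈ n · 1#
  +◃-homo n = reflexive (≡.cong ⟦_⟧ (ℤ.+◃n≡+n n))

  -◃-homo : ∀ n → ⟦ Sign.- ℤ.◃ n ⟧ ≈ - (n · 1#)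
  -◃-homo zero    = sym -0#≈0#
  -◃-homo (suc n) = refl

  *-homo : ∀ i j → ⟦ i ℤ.* j ⟧ ≈ ⟦ i ⟧ * ⟦ j ⟧
  *-homo (+ m)    (+ n)    = trans (+◃-homo (m ℕ.* n)) (×1-homo-* m n)
  *-homo (+ m)    -[1+ n ] =
    trans (-◃-homo (m ℕ.* suc n))
      (trans (-‿cong (×1-homo-* m (suc n))) (-‿distribʳ-* _ _))
  *-homo -[1+ m ] (+ n)    =
    trans (-◃-homo (suc m ℕ.* n))
      (trans (-‿cong (×1-homo-* (suc m) n)) (-‿distribˡ-* _ _))
  *-homo -[1+ m ] -[1+ n ] = begin
    (suc m ℕ.* suc n) · 1#             ≈⟨ ×1-homo-* (suc m) (suc n) ⟩
    suc m · 1# * suc n · 1#            ≈⟨ -‿involutive _ ⟨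
    - - (suc m · 1# * suc n · 1#)      ≈⟨ -‿cong (-‿distribˡ-* _ _) ⟩
    - (- (suc m · 1#) * suc n · 1#)    ≈⟨ -‿distribʳ-* _ _ ⟩
    - (suc m · 1#) * - (suc n · 1#)    ∎

  -‿homo : ∀ i → ⟦ ℤ.- i ⟧ ≈ - ⟦ i ⟧
  -‿homo (+ zero)  = sym -0#≈0#
  -‿homo (+ suc n) = refl
  -‿homo -[1+ n ]  = sym (-‿involutive _)

  morphism : ℤ.+-*-rawRing -Raw-AlmostCommutative⟶ fromCommutativeRing R
  morphism = record
    { ⟦_⟧    = ⟦_⟧
    ; +-homo = +-homo
    ; *-homo = *-homo
    ; -‿homo = -‿homo
    ; 0-homo = refl
    ; 1-homo = refl
    }

  module Solver = RingSolver ℤ.+-*-rawRing (fromCommutativeRing R) morphism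
    (λ i j → Maybe.map (reflexive ∘ ≡.cong ⟦_⟧) (dec⇒maybe (i ℤ.≟ j)))

-- Ordered field arithmetic.

module OrderedField {c ℓ} (ℝ : RealField c ℓ) where
  open RealField ℝ hiding (zero)
  open IsStrictTotalOrder isStrictTotalOrder public
    using (compare; _≟_; isStrictPartialOrder; <-respˡ-≈; <-respʳ-≈; irrefl)
  open RingProperties ring public
  open SemiringSum semiring public
    using (*-distribʳ-sum; sum-cong-≋; sum-replicate-zero)
  open IntegerCoefficients.Solver commutativeRing public
    using (solve; _:=_; _:+_; _:*_; _:-_; :-_; con)

  private
    strictPartialOrder : StrictPartialOrder c ℓ ℓ
    strictPartialOrder = record { isStrictPartialOrder = isStrictPartialOrder }

    module NonStrict = StrictToNonStrict _≈_ _<_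

  totalOrder : TotalOrder c ℓ ℓ
  totalOrder = record { isTotalOrder = NonStrict.isTotalOrder isStrictTotalOrder }

  module ≤ = TotalOrder totalOrder using (refl; trans; antisym)
  module ≤-Reasoning = StrictPartialOrderReasoning strictPartialOrder

  <⇒≤ : ∀ {x y} → x < y → x ≤ y
  <⇒≤ = inj₁

  ≤-reflexive : ∀ {x y} → x ≈ y → x ≤ y
  ≤-reflexive = inj₂

  ≤-respʳ : ∀ {x y z} → y ≈ z → x ≤ y → x ≤ z
  ≤-respʳ y≈z x≤y = ≤.trans x≤y (≤-reflexive y≈z)

  ≤-respˡ : ∀ {x y z} → y ≈ z → y ≤ x → z ≤ x
  ≤-respˡ y≈z y≤x = ≤.trans (≤-reflexive (sym y≈z)) y≤x

  ≤⇒≯ : ∀ {x y} → x ≤ y → ¬ (y < x)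
  ≤⇒≯ {x} {y} x≤y y<x = irrefl refl (begin-strict
    y ≈⟨ refl ⟩ y <⟨ y<x ⟩ x ≤⟨ x≤y ⟩ y ∎)
    where open ≤-Reasoning

  <⇒≉ : ∀ {x y} → x < y → x ≉ y
  <⇒≉ x<y x≈y = irrefl x≈y x<y

  ≰⇒> : ∀ {x y} → ¬ (x ≤ y) → y < x
  ≰⇒> {x} {y} x≰y with compare x y
  ... | tri< x<y _ _ = contradiction (<⇒≤ x<y) x≰y
  ... | tri≈ _ x≈y _ = contradiction (≤-reflexive x≈y) x≰y
  ... | tri> _ _ y<x = y<x

  ≤∧≉⇒< : ∀ {x y} → x ≤ y → x ≉ y → x < y
  ≤∧≉⇒< (inj₁ x<y) _   = x<y
  ≤∧≉⇒< (inj₂ x≈y) x≉y = contradiction x≈y x≉y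

  <-or-≥ : ∀ x y → x < y ⊎ y ≤ x
  <-or-≥ x y with compare x y
  ... | tri< x<y _ _ = inj₁ x<y
  ... | tri≈ _ x≈y _ = inj₂ (≤-reflexive (sym x≈y))
  ... | tri> _ _ y<x = inj₂ (<⇒≤ y<x)

  <-cong : ∀ {x x′ y y′} → x ≈ x′ → y ≈ y′ → x < y → x′ < y′
  <-cong x≈x′ y≈y′ x<y = <-respˡ-≈ x≈x′ (<-respʳ-≈ y≈y′ x<y)

  +-monoʳ-≤ : ∀ z {x y} → x ≤ y → z + x ≤ z + y
  +-monoʳ-≤ z (inj₁ x<y) = inj₁ (+-monoʳ-< z x<y)
  +-monoʳ-≤ z (inj₂ x≈y) = inj₂ (+-congˡ x≈y)

  +-monoˡ-≤ : ∀ z {x y} → x ≤ y → x + z ≤ y + z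
  +-monoˡ-≤ z {x} {y} x≤y =
    ≤-respˡ (+-comm z x) (≤-respʳ (+-comm z y) (+-monoʳ-≤ z x≤y))

  +-mono-≤ : ∀ {x y u v} → x ≤ y → u ≤ v → x + u ≤ y + v
  +-mono-≤ x≤y u≤v = ≤.trans (+-monoˡ-≤ _ x≤y) (+-monoʳ-≤ _ u≤v)

  +-mono-<-≤ : ∀ {x y u v} → x < y → u ≤ v → x + u < y + v
  +-mono-<-≤ {x} {y} {u} {v} x<y u≤v = begin-strict
    x + u ≈⟨ +-comm x u ⟩
    u + x <⟨ +-monoʳ-< u x<y ⟩
    u + y ≈⟨ +-comm u y ⟩
    y + u ≤⟨ +-monoʳ-≤ y u≤v ⟩
    y + v ∎
    where open ≤-Reasoning

  +-nonNeg : ∀ {x y} → 0# ≤ x → 0# ≤ y → 0# ≤ x + y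
  +-nonNeg 0≤x 0≤y = ≤-respˡ (+-identityˡ 0#) (+-mono-≤ 0≤x 0≤y)

  +-pos-nonNeg : ∀ {x y} → 0# < x → 0# ≤ y → 0# < x + y
  +-pos-nonNeg 0<x 0≤y = <-respˡ-≈ (+-identityˡ 0#) (+-mono-<-≤ 0<x 0≤y)

  x≤y⇒0≤y-x : ∀ {x y} → x ≤ y → 0# ≤ y - x
  x≤y⇒0≤y-x {x} x≤y = ≤-respˡ (-‿inverseʳ x) (+-monoˡ-≤ (- x) x≤y)

  0≤y-x⇒x≤y : ∀ {x y} → 0# ≤ y - x → x ≤ y
  0≤y-x⇒x≤y {x} {y} 0≤y-x = ≤-respˡ (+-identityʳ x)
    (≤-respʳ (solve 2 (λ x y → x :+ (y :- x) := y) refl x y) (+-monoʳ-≤ x 0≤y-x))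

  x<y⇒0<y-x : ∀ {x y} → x < y → 0# < y - x
  x<y⇒0<y-x {x} {y} x<y =
    <-cong (-‿inverseˡ x) (+-comm (- x) y) (+-monoʳ-< (- x) x<y)

  0<y-x⇒x<y : ∀ {x y} → 0# < y - x → x < y
  0<y-x⇒x<y {x} {y} 0<y-x =
    <-cong (+-identityʳ x) (solve 2 (λ x y → x :+ (y :- x) := y) refl x y)
      (+-monoʳ-< x 0<y-x)

  neg-pos : ∀ {x} → x < 0# → 0# < - x
  neg-pos {x} x<0 = <-respʳ-≈ (+-identityˡ (- x)) (x<y⇒0<y-x x<0)

  neg-mono-≤ : ∀ {x y} → x ≤ y → - y ≤ - x
  neg-mono-≤ {x} {y} x≤y = 0≤y-x⇒x≤y (≤-respʳ
    (solve 2 (λ x y → y :- x := :- x :- (:- y)) refl x y) (x≤y⇒0≤y-x x≤y))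

  neg-mono-< : ∀ {x y} → x < y → - y < - x
  neg-mono-< {x} {y} x<y = 0<y-x⇒x<y (<-respʳ-≈
    (solve 2 (λ x y → y :- x := :- x :- (:- y)) refl x y) (x<y⇒0<y-x x<y))

  *-nonNeg : ∀ {x y} → 0# ≤ x → 0# ≤ y → 0# ≤ x * y
  *-nonNeg         (inj₁ 0<x) (inj₁ 0<y) = inj₁ (*-pos 0<x 0<y)
  *-nonNeg {x}     (inj₁ _)   (inj₂ 0≈y) = inj₂ (sym (trans (*-congˡ (sym 0≈y)) (zeroʳ x)))
  *-nonNeg {_} {y} (inj₂ 0≈x) _          = inj₂ (sym (trans (*-congʳ (sym 0≈x)) (zeroˡ y)))

  *-monoˡ-≤ : ∀ {z x y} → 0# ≤ z → x ≤ y → z * x ≤ z * y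
  *-monoˡ-≤ {z} {x} {y} 0≤z x≤y =
    0≤y-x⇒x≤y (≤-respʳ (x[y-z]≈xy-xz z y x) (*-nonNeg 0≤z (x≤y⇒0≤y-x x≤y)))

  ⁻¹-cancelˡ : ∀ {x} y → x ≉ 0# → x ⁻¹ * (x * y) ≈ y
  ⁻¹-cancelˡ {x} y x≉0 = begin
    x ⁻¹ * (x * y)  ≈⟨ solve 3 (λ x y i → i :* (x :* y) := (x :* i) :* y) refl x y (x ⁻¹) ⟩
    (x * x ⁻¹) * y  ≈⟨ *-congʳ (⁻¹-inverseʳ x x≉0) ⟩
    1# * y          ≈⟨ *-identityˡ y ⟩
    y               ∎
    where open ≈-Reasoning setoid

  *-cancelˡ-≉0 : ∀ {x y z} → x ≉ 0# → x * y ≈ x * z → y ≈ z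
  *-cancelˡ-≉0 {x} {y} {z} x≉0 xy≈xz = begin
    y               ≈⟨ ⁻¹-cancelˡ y x≉0 ⟨
    x ⁻¹ * (x * y)  ≈⟨ *-congˡ xy≈xz ⟩
    x ⁻¹ * (x * z)  ≈⟨ ⁻¹-cancelˡ z x≉0 ⟩
    z               ∎
    where open ≈-Reasoning setoid

  x*y≈0∧x≉0⇒y≈0 : ∀ {x y} → x * y ≈ 0# → x ≉ 0# → y ≈ 0#
  x*y≈0∧x≉0⇒y≈0 {x} xy≈0 x≉0 = *-cancelˡ-≉0 x≉0 (trans xy≈0 (sym (zeroʳ x)))

  *-monoˡ-< : ∀ {z x y} → 0# < z → x < y → z * x < z * y
  *-monoˡ-< {z} {x} {y} 0<z x<y =
    0<y-x⇒x<y (<-respʳ-≈ (x[y-z]≈xy-xz z y x) (*-pos 0<z (x<y⇒0<y-x x<y)))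

  *-cancelˡ-≤ : ∀ {z x y} → 0# < z → z * x ≤ z * y → x ≤ y
  *-cancelˡ-≤ {z} {x} {y} 0<z zx≤zy with compare x y
  ... | tri< x<y _ _ = <⇒≤ x<y
  ... | tri≈ _ x≈y _ = ≤-reflexive x≈y
  ... | tri> _ _ y<x = contradiction (*-monoˡ-< 0<z y<x) (≤⇒≯ zx≤zy)

  *-cancelˡ-< : ∀ {z x y} → 0# < z → z * x < z * y → x < y
  *-cancelˡ-< 0<z zx<zy = ≰⇒> λ y≤x → ≤⇒≯ (*-monoˡ-≤ (<⇒≤ 0<z) y≤x) zx<zy

  0≤1 : 0# ≤ 1#
  0≤1 = <⇒≤ 0<1

  0<2 : 0# < 1# + 1#
  0<2 = +-pos-nonNeg 0<1 0≤1

  nonNeg⇒≉-1 : ∀ {x} → 0# ≤ x → x ≉ - 1#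
  nonNeg⇒≉-1 0≤x x≈-1 = ≤⇒≯ (≤-respʳ x≈-1 0≤x)
    (<-respʳ-≈ -0#≈0# (neg-mono-< 0<1))

  0≤n·1 : ∀ n → 0# ≤ n · 1#
  0≤n·1 zero    = ≤.refl
  0≤n·1 (suc n) = +-nonNeg 0≤1 (0≤n·1 n)

  -- The gap between 1 and 2 is all that integrality contributes: it separates Cartan integers whose
  -- reflection is a plain difference from those that force a length inequality.
  fromℤ-pos : ∀ i → 0# < fromℤ i → fromℤ i ≈ 1# ⊎ 1# + 1# ≤ fromℤ i
  fromℤ-pos (+ 0)           0<i = contradiction 0<i (irrefl refl)
  fromℤ-pos (+ 1)           0<i = inj₁ (+-identityʳ 1#)
  fromℤ-pos (+ suc (suc n)) 0<i = inj₂ (≤-respʳ (+-assoc 1# 1# (n · 1#))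
    (≤-respˡ (+-identityʳ (1# + 1#)) (+-monoʳ-≤ (1# + 1#) (0≤n·1 n))))
  fromℤ-pos -[1+ n ]        0<i = contradiction
    (<-respʳ-≈ (-‿inverseˡ (suc n · 1#)) (+-pos-nonNeg 0<i (0≤n·1 (suc n))))
    (irrefl refl)

  sum-mono-≤ : ∀ {n} {f g : Vector Carrier n} → (∀ i → f i ≤ g i) → ∑ f ≤ ∑ g
  sum-mono-≤ {zero}  f≤g = ≤.refl
  sum-mono-≤ {suc n} f≤g = +-mono-≤ (f≤g zero) (sum-mono-≤ (f≤g ∘ suc))

  -- A strict inequality in one term would make the whole sum strict. Applied to weighted heights,
  -- this is the equality case of an average.
  sum-mono-≤-≈ : ∀ {n} {f g : Vector Carrier n} → (∀ i → f i ≤ g i) →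
                 ∑ f ≈ ∑ g → ∀ i → f i ≈ g i
  sum-mono-≤-≈ {suc n} {f} {g} f≤g ∑f≈∑g i with f≤g zero
  ... | inj₁ f₀<g₀ = contradiction
    (+-mono-<-≤ f₀<g₀ (sum-mono-≤ (f≤g ∘ suc))) (irrefl ∑f≈∑g)
  ... | inj₂ f₀≈g₀ with i
  ...   | zero  = f₀≈g₀
  ...   | suc j = sum-mono-≤-≈ (f≤g ∘ suc)
    (+-cancelˡ (g zero) _ _ (trans (+-congʳ (sym f₀≈g₀)) ∑f≈∑g)) j

  ⁻¹-pos : ∀ {x} → 0# < x → 0# < x ⁻¹
  ⁻¹-pos {x} 0<x = *-cancelˡ-< 0<x
    (<-cong (sym (zeroʳ x)) (sym (⁻¹-inverseʳ x (<⇒≉ 0<x ∘ sym))) 0<1)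

-- Vectors, averages and segments.

module Euclidean {c ℓ m ℓm} {ℝ : RealField c ℓ} (E : EuclideanSpace ℝ m ℓm) where
  open RealField ℝ hiding (zero)
  open OrderedField ℝ
  open EuclideanSpace E
  open Convexity E
  module +ᴹ = AbelianGroupProperties +ᴹ-abelianGroup
  private
    module ≈R = ≈-Reasoning setoid
    module ≈M = ≈-Reasoning setoidᴹ

  ⟨⟩-congˡ : ∀ {u v} z → u ≈ᴹ v → ⟨ u , z ⟩ ≈ ⟨ v , z ⟩
  ⟨⟩-congˡ z u≈v = ⟨⟩-cong u≈v ≈ᴹ-refl

  ⟨⟩-congʳ : ∀ {u v} z → u ≈ᴹ v → ⟨ z , u ⟩ ≈ ⟨ z , v ⟩
  ⟨⟩-congʳ z u≈v = ⟨⟩-cong ≈ᴹ-refl u≈v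

  ⟨⟩-0ˡ : ∀ z → ⟨ 0ᴹ , z ⟩ ≈ 0#
  ⟨⟩-0ˡ z = begin
    ⟨ 0ᴹ , z ⟩         ≈⟨ ⟨⟩-congˡ z (*ₗ-zeroˡ z) ⟨
    ⟨ 0# *ₗ z , z ⟩    ≈⟨ ⟨⟩-*ˡ 0# z z ⟩
    0# * ⟨ z , z ⟩     ≈⟨ zeroˡ _ ⟩
    0#                 ∎
    where open ≈R

  ⟨⟩-negˡ : ∀ u z → ⟨ -ᴹ u , z ⟩ ≈ - ⟨ u , z ⟩
  ⟨⟩-negˡ u z = +-inverseˡ-unique _ _ (begin
    ⟨ -ᴹ u , z ⟩ + ⟨ u , z ⟩    ≈⟨ ⟨⟩-+ˡ (-ᴹ u) u z ⟨
    ⟨ -ᴹ u +ᴹ u , z ⟩           ≈⟨ ⟨⟩-congˡ z (-ᴹ‿inverseˡ u) ⟩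
    ⟨ 0ᴹ , z ⟩                  ≈⟨ ⟨⟩-0ˡ z ⟩
    0#                          ∎)
    where open ≈R

  ⟨⟩--ˡ : ∀ u v z → ⟨ u -ᴹ v , z ⟩ ≈ ⟨ u , z ⟩ - ⟨ v , z ⟩
  ⟨⟩--ˡ u v z = trans (⟨⟩-+ˡ u (-ᴹ v) z) (+-congˡ (⟨⟩-negˡ v z))

  ⟨⟩-comb : ∀ s t u v z → ⟨ s *ₗ u +ᴹ t *ₗ v , z ⟩ ≈ s * ⟨ u , z ⟩ + t * ⟨ v , z ⟩
  ⟨⟩-comb s t u v z =
    trans (⟨⟩-+ˡ _ _ z) (+-cong (⟨⟩-*ˡ s u z) (⟨⟩-*ˡ t v z))

  ⟨⟩-+*ˡ : ∀ u t v z → ⟨ u +ᴹ t *ₗ v , z ⟩ ≈ ⟨ u , z ⟩ + t * ⟨ v , z ⟩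
  ⟨⟩-+*ˡ u t v z = trans (⟨⟩-+ˡ _ _ z) (+-congˡ (⟨⟩-*ˡ t v z))

  -- Testing against `u -ᴹ v` itself gives a vector of norm zero. Vector identities thus become
  -- scalar ones, within reach of the ring solver.
  ⟨⟩-ext : ∀ {u v} → (∀ z → ⟨ u , z ⟩ ≈ ⟨ v , z ⟩) → u ≈ᴹ v
  ⟨⟩-ext {u} {v} u≗v = +ᴹ.x∙y⁻¹≈ε⇒x≈y u v (⟨⟩-definite _
    (trans (⟨⟩--ˡ u v (u -ᴹ v)) (+ᴿ.x≈y⇒x∙y⁻¹≈ε (u≗v (u -ᴹ v)))))
    where module +ᴿ = AbelianGroupProperties +-abelianGroup

  infix 4 _≟ᴹ_
  -- Decided by whether the squared norm of the difference vanishes; this makes membership in a list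
  -- of roots decidable.
  _≟ᴹ_ : ∀ u v → Dec (u ≈ᴹ v)
  u ≟ᴹ v = map′ (λ eq → +ᴹ.x∙y⁻¹≈ε⇒x≈y u v (⟨⟩-definite _ eq))
    (λ u≈v → trans (⟨⟩-congˡ _ (+ᴹ.x≈y⇒x∙y⁻¹≈ε u≈v)) (⟨⟩-0ˡ _))
    (⟨ u -ᴹ v , u -ᴹ v ⟩ ≟ 0#)

  ⟨⟩-pos : ∀ {v} → v ≉ᴹ 0ᴹ → 0# < ⟨ v , v ⟩
  ⟨⟩-pos {v} v≉0 = ≤∧≉⇒< (⟨⟩-nonNeg v) (v≉0 ∘ ⟨⟩-definite v ∘ sym)

  -ᴹ-nonzero : ∀ {u v} → u ≉ᴹ v → u -ᴹ v ≉ᴹ 0ᴹ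
  -ᴹ-nonzero u≉v = u≉v ∘ +ᴹ.x∙y⁻¹≈ε⇒x≈y _ _

  ⟨⟩-linComb : ∀ {n} (a : Vector Carrier n) p z →
               ⟨ linComb a p , z ⟩ ≈ ∑ (λ i → a i * ⟨ p i , z ⟩)
  ⟨⟩-linComb {zero}  a p z = ⟨⟩-0ˡ z
  ⟨⟩-linComb {suc n} a p z = trans (⟨⟩-+ˡ _ _ z)
    (+-cong (⟨⟩-*ˡ (a zero) (p zero) z) (⟨⟩-linComb (a ∘ suc) (p ∘ suc) z))

  sum-weighted : ∀ {n} (a : Vector Carrier n) b → ∑ a ≈ 1# → ∑ (λ i → a i * b) ≈ b
  sum-weighted a b ∑a≈1 =
    trans (sym (*-distribʳ-sum b a)) (trans (*-congʳ ∑a≈1) (*-identityˡ b))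

  module _ {n} {a : Vector Carrier n} (∑a≈1 : ∑ a ≈ 1#) where

    -- Points of zero weight are left unconstrained, because a convex combination may list roots
    -- that do not contribute.
    linComb-const : ∀ {p v} → (∀ i → a i ≈ 0# ⊎ p i ≈ᴹ v) → linComb a p ≈ᴹ v
    linComb-const {p} {v} const = ⟨⟩-ext λ z → begin
      ⟨ linComb a p , z ⟩          ≈⟨ ⟨⟩-linComb a p z ⟩
      ∑ (λ i → a i * ⟨ p i , z ⟩)  ≈⟨ sum-cong-≋ (λ i → term i z) ⟩
      ∑ (λ i → a i * ⟨ v , z ⟩)    ≈⟨ sum-weighted a _ ∑a≈1 ⟩
      ⟨ v , z ⟩                    ∎
      where
      open ≈R
      term : ∀ i z → a i * ⟨ p i , z ⟩ ≈ a i * ⟨ v , z ⟩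
      term i z with const i
      ... | inj₁ aᵢ≈0 = trans (*-congʳ aᵢ≈0)
        (trans (zeroˡ _) (sym (trans (*-congʳ aᵢ≈0) (zeroˡ _))))
      ... | inj₂ pᵢ≈v = *-congˡ (⟨⟩-congˡ z pᵢ≈v)

    module _ (0≤a : ∀ i → 0# ≤ a i) {p : Vector Carrierᴹ n} {z : Carrierᴹ} {b : Carrier}
             (bounded : ∀ i → a i ≈ 0# ⊎ ⟨ p i , z ⟩ ≤ b) where

      private
        term-≤ : ∀ i → a i * ⟨ p i , z ⟩ ≤ a i * b
        term-≤ i with bounded i
        ... | inj₁ aᵢ≈0 = ≤-reflexive (trans (*-congʳ aᵢ≈0)
          (trans (zeroˡ _) (sym (trans (*-congʳ aᵢ≈0) (zeroˡ _)))))
        ... | inj₂ pᵢ≤b = *-monoˡ-≤ (0≤a i) pᵢ≤b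

      convex-≤ : ⟨ linComb a p , z ⟩ ≤ b
      convex-≤ = ≤-respˡ (sym (⟨⟩-linComb a p z))
        (≤-respʳ (sum-weighted a b ∑a≈1) (sum-mono-≤ term-≤))

      convex-≈ : ⟨ linComb a p , z ⟩ ≈ b → ∀ i → a i ≈ 0# ⊎ ⟨ p i , z ⟩ ≈ b
      convex-≈ lc≈b i with a i ≟ 0#
      ... | yes aᵢ≈0 = inj₁ aᵢ≈0
      ... | no  aᵢ≉0 = inj₂ (*-cancelˡ-≉0 aᵢ≉0 (sum-mono-≤-≈ term-≤
        (trans (sym (⟨⟩-linComb a p z)) (trans lc≈b (sym (sum-weighted a b ∑a≈1)))) i))

  ∈⇒ConvexHull : ∀ {s} {S : Pred Carrierᴹ s} {x} → S x → ConvexHull S x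
  ∈⇒ConvexHull {x = x} x∈S =
    1 , (λ _ → x) , (λ _ → 1#) , (λ _ → x∈S) , (λ _ → 0≤1) , +-identityʳ 1# ,
    ≈ᴹ-sym (≈ᴹ-trans (+ᴹ-identityʳ _) (*ₗ-identityˡ x))

  ConvexHull-resp : ∀ {s} {S : Pred Carrierᴹ s} {x y} → x ≈ᴹ y →
                    ConvexHull S x → ConvexHull S y
  ConvexHull-resp x≈y (n , p , a , p∈S , 0≤a , ∑a≈1 , x≈lc) =
    n , p , a , p∈S , 0≤a , ∑a≈1 , ≈ᴹ-trans (≈ᴹ-sym x≈y) x≈lc

  Segment : Carrierᴹ → Carrierᴹ → Pred Carrierᴹ (c ⊔ ℓ ⊔ ℓm)
  Segment g g′ x = ∃[ s ] ∃[ t ] (0# ≤ s × 0# ≤ t × s + t ≈ 1# × x ≈ᴹ s *ₗ g +ᴹ t *ₗ g′)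

  Segment-sym : ∀ {g g′ x} → Segment g g′ x → Segment g′ g x
  Segment-sym (s , t , 0≤s , 0≤t , s+t≈1 , x≈) =
    t , s , 0≤t , 0≤s , trans (+-comm t s) s+t≈1 , ≈ᴹ-trans x≈ (+ᴹ-comm _ _)

  Segment-cong : ∀ {g g′ h h′ x} → g ≈ᴹ h → g′ ≈ᴹ h′ → Segment g g′ x → Segment h h′ x
  Segment-cong g≈h g′≈h′ (s , t , 0≤s , 0≤t , s+t≈1 , x≈) =
    s , t , 0≤s , 0≤t , s+t≈1 ,
    ≈ᴹ-trans x≈ (+ᴹ-cong (*ₗ-congˡ g≈h) (*ₗ-congˡ g′≈h′))

  line-segment : ∀ {o u g g′ x t₀ t₁ t} →
                 g ≈ᴹ o +ᴹ t₁ *ₗ u → g′ ≈ᴹ o +ᴹ t₀ *ₗ u → x ≈ᴹ o +ᴹ t *ₗ u →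
                 t₀ < t₁ → t₀ ≤ t → t ≤ t₁ → Segment g g′ x
  line-segment {o} {u} {g} {g′} {x} {t₀} {t₁} {t} g≈ g′≈ x≈ t₀<t₁ t₀≤t t≤t₁ =
    -- Barycentric weights: the distance to the opposite end divided by the length `t₁ - t₀`.
    (t - t₀) * i , (t₁ - t) * i ,
    *-nonNeg (x≤y⇒0≤y-x t₀≤t) 0≤i , *-nonNeg (x≤y⇒0≤y-x t≤t₁) 0≤i ,
    trans (solve 4 (λ t t₀ t₁ i → (t :- t₀) :* i :+ (t₁ :- t) :* i := (t₁ :- t₀) :* i)
            refl t t₀ t₁ i) d*i≈1 ,
    ⟨⟩-ext λ z → begin
      ⟨ x , z ⟩
        ≈⟨ ⟨⟩-congˡ z x≈ ⟩
      ⟨ o +ᴹ t *ₗ u , z ⟩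
        ≈⟨ ⟨⟩-+*ˡ o t u z ⟩
      ⟨ o , z ⟩ + t * ⟨ u , z ⟩
        ≈⟨ *-identityˡ _ ⟨
      1# * (⟨ o , z ⟩ + t * ⟨ u , z ⟩)
        ≈⟨ *-congʳ d*i≈1 ⟨
      (t₁ - t₀) * i * (⟨ o , z ⟩ + t * ⟨ u , z ⟩)
        ≈⟨ solve 6 (λ t t₀ t₁ i o u →
             (t₁ :- t₀) :* i :* (o :+ t :* u) :=
             (t :- t₀) :* i :* (o :+ t₁ :* u) :+ (t₁ :- t) :* i :* (o :+ t₀ :* u))
             refl t t₀ t₁ i _ _ ⟩
      (t - t₀) * i * (⟨ o , z ⟩ + t₁ * ⟨ u , z ⟩) + (t₁ - t) * i * (⟨ o , z ⟩ + t₀ * ⟨ u , z ⟩)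
        ≈⟨ +-cong (*-congˡ (pair g≈ z)) (*-congˡ (pair g′≈ z)) ⟨
      (t - t₀) * i * ⟨ g , z ⟩ + (t₁ - t) * i * ⟨ g′ , z ⟩
        ≈⟨ ⟨⟩-comb _ _ g g′ z ⟨
      ⟨ ((t - t₀) * i) *ₗ g +ᴹ ((t₁ - t) * i) *ₗ g′ , z ⟩ ∎
    where
    open ≈R
    i = (t₁ - t₀) ⁻¹
    0<d = x<y⇒0<y-x t₀<t₁
    d*i≈1 = ⁻¹-inverseʳ (t₁ - t₀) (<⇒≉ 0<d ∘ sym)
    0≤i = <⇒≤ (⁻¹-pos 0<d)
    pair : ∀ {y k} → y ≈ᴹ o +ᴹ k *ₗ u → ∀ z → ⟨ y , z ⟩ ≈ ⟨ o , z ⟩ + k * ⟨ u , z ⟩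
    pair y≈ z = trans (⟨⟩-congˡ z y≈) (⟨⟩-+*ˡ o _ u z)

  step-0 : ∀ u v → u ≈ᴹ u +ᴹ fromℤ (+ 0) *ₗ v
  step-0 u v = ≈ᴹ-sym (≈ᴹ-trans (+ᴹ-congˡ (*ₗ-zeroˡ v)) (+ᴹ-identityʳ u))

  step-1 : ∀ {u v d} → d ≈ᴹ v -ᴹ u → v ≈ᴹ u +ᴹ fromℤ (+ 1) *ₗ d
  step-1 {u} {v} {d} d≈v-u = ⟨⟩-ext λ z → begin
    ⟨ v , z ⟩
      -- `fromℤ (+ 1)` unfolds to `1# + 0#`, not to `1#`, and the solver expression copies that
      -- shape.
      ≈⟨ solve 2 (λ u v → v := u :+ (con (+ 1) :+ con (+ 0)) :* (v :- u)) refl _ _ ⟩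
    ⟨ u , z ⟩ + fromℤ (+ 1) * (⟨ v , z ⟩ - ⟨ u , z ⟩)
      ≈⟨ +-congˡ (*-congˡ (trans (⟨⟩-congˡ z d≈v-u) (⟨⟩--ˡ v u z))) ⟨
    ⟨ u , z ⟩ + fromℤ (+ 1) * ⟨ d , z ⟩
      ≈⟨ ⟨⟩-+*ˡ u _ d z ⟨
    ⟨ u +ᴹ fromℤ (+ 1) *ₗ d , z ⟩ ∎
    where open ≈R

  step-2 : ∀ {u v x d} → d ≈ᴹ v -ᴹ x → d ≈ᴹ x -ᴹ u → v ≈ᴹ u +ᴹ fromℤ (+ 2) *ₗ d
  step-2 {u} {v} {x} {d} d≈v-x d≈x-u = ⟨⟩-ext λ z → begin
    ⟨ v , z ⟩
      ≈⟨ solve 3 (λ u v x → v := u :+ ((v :- x) :+ (x :- u))) refl ⟨ u , z ⟩ _ ⟨ x , z ⟩ ⟩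
    ⟨ u , z ⟩ + ((⟨ v , z ⟩ - ⟨ x , z ⟩) + (⟨ x , z ⟩ - ⟨ u , z ⟩))
      ≈⟨ +-congˡ (+-cong (trans (⟨⟩-congˡ z d≈v-x) (⟨⟩--ˡ v x z))
                         (trans (⟨⟩-congˡ z d≈x-u) (⟨⟩--ˡ x u z))) ⟨
    ⟨ u , z ⟩ + (⟨ d , z ⟩ + ⟨ d , z ⟩)
      ≈⟨ +-congˡ (solve 1 (λ d → (con (+ 1) :+ (con (+ 1) :+ con (+ 0))) :* d := d :+ d) refl _) ⟨
    ⟨ u , z ⟩ + fromℤ (+ 2) * ⟨ d , z ⟩
      ≈⟨ ⟨⟩-+*ˡ u _ d z ⟨
    ⟨ u +ᴹ fromℤ (+ 2) *ₗ d , z ⟩ ∎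
    where open ≈R

  module OnLine {g g′ x s t} (s+t≈1 : s + t ≈ 1#) (x≈ : x ≈ᴹ s *ₗ g +ᴹ t *ₗ g′) where

    ⟨⟩-point : ∀ z → ⟨ x , z ⟩ ≈ s * ⟨ g , z ⟩ + t * ⟨ g′ , z ⟩
    ⟨⟩-point z = trans (⟨⟩-congˡ z x≈) (⟨⟩-comb s t g g′ z)

    left : g -ᴹ x ≈ᴹ t *ₗ (g -ᴹ g′)
    left = ⟨⟩-ext λ z → begin
      ⟨ g -ᴹ x , z ⟩
        ≈⟨ ⟨⟩--ˡ g x z ⟩
      ⟨ g , z ⟩ - ⟨ x , z ⟩
        ≈⟨ +-cong (trans (sym (*-identityˡ _)) (*-congʳ (sym s+t≈1))) (-‿cong (⟨⟩-point z)) ⟩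
      (s + t) * ⟨ g , z ⟩ - (s * ⟨ g , z ⟩ + t * ⟨ g′ , z ⟩)
        ≈⟨ solve 4 (λ s t g g′ → (s :+ t) :* g :- (s :* g :+ t :* g′) := t :* (g :- g′))
             refl s t _ _ ⟩
      t * (⟨ g , z ⟩ - ⟨ g′ , z ⟩)
        ≈⟨ *-congˡ (⟨⟩--ˡ g g′ z) ⟨
      t * ⟨ g -ᴹ g′ , z ⟩
        ≈⟨ ⟨⟩-*ˡ t _ z ⟨
      ⟨ t *ₗ (g -ᴹ g′) , z ⟩ ∎
      where open ≈R

    right : x -ᴹ g′ ≈ᴹ s *ₗ (g -ᴹ g′)
    right = ⟨⟩-ext λ z → begin
      ⟨ x -ᴹ g′ , z ⟩
        ≈⟨ ⟨⟩--ˡ x g′ z ⟩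
      ⟨ x , z ⟩ - ⟨ g′ , z ⟩
        ≈⟨ +-cong (⟨⟩-point z) (-‿cong (trans (sym (*-identityˡ _)) (*-congʳ (sym s+t≈1)))) ⟩
      s * ⟨ g , z ⟩ + t * ⟨ g′ , z ⟩ - (s + t) * ⟨ g′ , z ⟩
        ≈⟨ solve 4 (λ s t g g′ → s :* g :+ t :* g′ :- (s :+ t) :* g′ := s :* (g :- g′))
             refl s t _ _ ⟩
      s * (⟨ g , z ⟩ - ⟨ g′ , z ⟩)
        ≈⟨ *-congˡ (⟨⟩--ˡ g g′ z) ⟨
      s * ⟨ g -ᴹ g′ , z ⟩
        ≈⟨ ⟨⟩-*ˡ s _ z ⟨
      ⟨ s *ₗ (g -ᴹ g′) , z ⟩ ∎
      where open ≈R

    t/s-scaled : s ≉ 0# → (t * s ⁻¹) *ₗ (x -ᴹ g′) ≈ᴹ g -ᴹ x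
    t/s-scaled s≉0 = begin
      (t * s ⁻¹) *ₗ (x -ᴹ g′)          ≈⟨ *ₗ-congˡ right ⟩
      (t * s ⁻¹) *ₗ s *ₗ (g -ᴹ g′)     ≈⟨ *ₗ-assoc _ _ _ ⟨
      (t * s ⁻¹ * s) *ₗ (g -ᴹ g′)      ≈⟨ *ₗ-congʳ cancel ⟩
      t *ₗ (g -ᴹ g′)                   ≈⟨ left ⟨
      g -ᴹ x                           ∎
      where
      open ≈M
      cancel : t * s ⁻¹ * s ≈ t
      cancel = trans (solve 3 (λ s t i → t :* i :* s := i :* (s :* t)) refl s t (s ⁻¹))
        (⁻¹-cancelˡ t s≉0)

    t≈0⇒x≈g : t ≈ 0# → x ≈ᴹ g
    t≈0⇒x≈g t≈0 = ≈ᴹ-sym (+ᴹ.x∙y⁻¹≈ε⇒x≈y g x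
      (≈ᴹ-trans left (≈ᴹ-trans (*ₗ-congʳ t≈0) (*ₗ-zeroˡ _))))

    s≈0⇒x≈g′ : s ≈ 0# → x ≈ᴹ g′
    s≈0⇒x≈g′ s≈0 = +ᴹ.x∙y⁻¹≈ε⇒x≈y x g′
      (≈ᴹ-trans right (≈ᴹ-trans (*ₗ-congʳ s≈0) (*ₗ-zeroˡ _)))

-- Root systems: Cartan integers and connectedness.

module Roots {c ℓ m ℓm} {ℝ : RealField c ℓ} (E : EuclideanSpace ℝ m ℓm) where
  open RealField ℝ hiding (zero)
  open OrderedField ℝ
  open EuclideanSpace E
  open Convexity E
  open RootSystems E
  open Euclidean E

  module RootSystem (Φ : List Carrierᴹ) (rootSystem : IsRootSystem Φ) where
    open IsRootSystem rootSystem

    ∈-resp : ∀ {x y} → x ≈ᴹ y → x ∈ Φ → y ∈ Φ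
    ∈-resp = Membership.∈-resp-≈ setoidᴹ

    infix 4 _∈?_
    _∈?_ : ∀ x xs → Dec (x ∈ xs)
    x ∈? xs = any? (x ≟ᴹ_) xs

    root-pos : ∀ {α} → α ∈ Φ → 0# < ⟨ α , α ⟩
    root-pos α∈Φ = ⟨⟩-pos (nonzero α∈Φ)

    root-≉0 : ∀ {α} → α ∈ Φ → ⟨ α , α ⟩ ≉ 0#
    root-≉0 α∈Φ = <⇒≉ (root-pos α∈Φ) ∘ sym

    -- Clears the inverse hidden in `cartan`, so that signs and sizes of Cartan integers are read
    -- off from scalar products.
    cartan-norm : ∀ {α} β → α ∈ Φ → ⟨ α , α ⟩ * cartan β α ≈ (1# + 1#) * ⟨ β , α ⟩
    cartan-norm {α} β α∈Φ = begin
      ⟨ α , α ⟩ * ((1# + 1#) * ⟨ β , α ⟩ * ⟨ α , α ⟩ ⁻¹)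
        ≈⟨ solve 3 (λ n b i → n :* (b :* i) := b :* (n :* i)) refl _ _ _ ⟩
      (1# + 1#) * ⟨ β , α ⟩ * (⟨ α , α ⟩ * ⟨ α , α ⟩ ⁻¹)
        ≈⟨ *-congˡ (⁻¹-inverseʳ _ (root-≉0 α∈Φ)) ⟩
      (1# + 1#) * ⟨ β , α ⟩ * 1#
        ≈⟨ *-identityʳ _ ⟩
      (1# + 1#) * ⟨ β , α ⟩ ∎
      where open ≈-Reasoning setoid

    ⟨⟩-reflect : ∀ α β z → ⟨ reflect α β , z ⟩ ≈ ⟨ β , z ⟩ - cartan β α * ⟨ α , z ⟩
    ⟨⟩-reflect α β z = trans (⟨⟩--ˡ β _ z) (+-congˡ (-‿cong (⟨⟩-*ˡ (cartan β α) α z)))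

    ⟨⟩-reflect-self : ∀ {α} β → α ∈ Φ → ⟨ reflect α β , α ⟩ ≈ - ⟨ β , α ⟩
    ⟨⟩-reflect-self {α} β α∈Φ = begin
      ⟨ reflect α β , α ⟩                    ≈⟨ ⟨⟩-reflect α β α ⟩
      ⟨ β , α ⟩ - cartan β α * ⟨ α , α ⟩     ≈⟨ +-congˡ (-‿cong (*-comm _ _)) ⟩
      ⟨ β , α ⟩ - ⟨ α , α ⟩ * cartan β α     ≈⟨ +-congˡ (-‿cong (cartan-norm β α∈Φ)) ⟩
      ⟨ β , α ⟩ - (1# + 1#) * ⟨ β , α ⟩      ≈⟨ solve 1 (λ b → b :- con (+ 2) :* b := :- b) refl _ ⟩
      - ⟨ β , α ⟩                            ∎
      where open ≈-Reasoning setoid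

    ⟨⟩-reflect-⊥ : ∀ {α z} β → ⟨ α , z ⟩ ≈ 0# → ⟨ reflect α β , z ⟩ ≈ ⟨ β , z ⟩
    ⟨⟩-reflect-⊥ {α} {z} β α⊥z = begin
      ⟨ reflect α β , z ⟩                 ≈⟨ ⟨⟩-reflect α β z ⟩
      ⟨ β , z ⟩ - cartan β α * ⟨ α , z ⟩  ≈⟨ +-congˡ (-‿cong (trans (*-congˡ α⊥z) (zeroʳ _))) ⟩
      ⟨ β , z ⟩ - 0#                      ≈⟨ trans (+-congˡ -0#≈0#) (+-identityʳ _) ⟩
      ⟨ β , z ⟩                           ∎
      where open ≈-Reasoning setoid

    neg-root : ∀ {α} → α ∈ Φ → -ᴹ α ∈ Φ
    neg-root {α} α∈Φ = ∈-resp (⟨⟩-ext λ z → begin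
      ⟨ reflect α α , z ⟩                    ≈⟨ ⟨⟩-reflect α α z ⟩
      ⟨ α , z ⟩ - cartan α α * ⟨ α , z ⟩     ≈⟨ +-congˡ (-‿cong (*-congʳ cartan≈2)) ⟩
      ⟨ α , z ⟩ - (1# + 1#) * ⟨ α , z ⟩      ≈⟨ solve 1 (λ b → b :- con (+ 2) :* b := :- b) refl _ ⟩
      - ⟨ α , z ⟩                            ≈⟨ ⟨⟩-negˡ α z ⟨
      ⟨ -ᴹ α , z ⟩                           ∎) (reflection α∈Φ α∈Φ)
      where
      open ≈-Reasoning setoid
      cartan≈2 : cartan α α ≈ 1# + 1#
      cartan≈2 = *-cancelˡ-≉0 (root-≉0 α∈Φ) (trans (cartan-norm α α∈Φ) (*-comm _ _))

    -ᴹ-swap-root : ∀ {α β} → α -ᴹ β ∈ Φ → β -ᴹ α ∈ Φ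
    -ᴹ-swap-root {α} {β} α-β∈Φ = ∈-resp (+ᴹ.⁻¹-anti-homo‿- α β) (neg-root α-β∈Φ)

    module _ (crystallographic : Crystallographic Φ) where

      cartan-pos : ∀ {α β} → α ∈ Φ → β ∈ Φ → 0# < ⟨ β , α ⟩ →
                   cartan β α ≈ 1# ⊎ 1# + 1# ≤ cartan β α
      cartan-pos {α} {β} α∈Φ β∈Φ 0<βα with crystallographic α∈Φ β∈Φ
      ... | n , c≈n with fromℤ-pos n (<-respʳ-≈ c≈n (*-cancelˡ-< (root-pos α∈Φ)
              (<-cong (sym (zeroʳ _)) (sym (cartan-norm β α∈Φ)) (*-pos 0<2 0<βα))))
      ...   | inj₁ n≈1 = inj₁ (trans c≈n n≈1)
      ...   | inj₂ 2≤n = inj₂ (≤-respʳ (sym c≈n) 2≤n)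

      1≤cartan : ∀ {α β} → α ∈ Φ → β ∈ Φ → 0# < ⟨ β , α ⟩ → 1# ≤ cartan β α
      1≤cartan α∈Φ β∈Φ 0<βα with cartan-pos α∈Φ β∈Φ 0<βα
      ... | inj₁ c≈1 = ≤-reflexive (sym c≈1)
      ... | inj₂ 2≤c = ≤.trans (≤-respˡ (+-identityʳ 1#) (+-monoʳ-≤ 1# 0≤1)) 2≤c

      -- Cartan integer 1 makes the reflection of `β` in `α` equal to `β -ᴹ α`; otherwise it is at
      -- least 2, and clearing the denominator gives the inequality.
      reflect-or-long : ∀ {α β} → α ∈ Φ → β ∈ Φ → 0# < ⟨ β , α ⟩ →
                        β -ᴹ α ∈ Φ ⊎ ⟨ α , α ⟩ ≤ ⟨ β , α ⟩
      reflect-or-long {α} {β} α∈Φ β∈Φ 0<βα with cartan-pos α∈Φ β∈Φ 0<βα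
      ... | inj₁ c≈1 = inj₁ (∈-resp
        (+ᴹ-congˡ (-ᴹ‿cong (≈ᴹ-trans (*ₗ-congʳ c≈1) (*ₗ-identityˡ α)))) (reflection α∈Φ β∈Φ))
      ... | inj₂ 2≤c = inj₂ (*-cancelˡ-≤ 0<2 (begin
        (1# + 1#) * ⟨ α , α ⟩      ≈⟨ *-comm _ _ ⟩
        ⟨ α , α ⟩ * (1# + 1#)      ≤⟨ *-monoˡ-≤ (<⇒≤ (root-pos α∈Φ)) 2≤c ⟩
        ⟨ α , α ⟩ * cartan β α     ≈⟨ cartan-norm β α∈Φ ⟩
        (1# + 1#) * ⟨ β , α ⟩      ∎))
        where open ≤-Reasoning

      -- If both Cartan integers were at least 2, then |α - β|² ≤ 0.
      difference-root : ∀ {α β} → α ∈ Φ → β ∈ Φ → α ≉ᴹ β → 0# < ⟨ α , β ⟩ → α -ᴹ β ∈ Φ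
      difference-root {α} {β} α∈Φ β∈Φ α≉β 0<αβ
        with reflect-or-long β∈Φ α∈Φ 0<αβ
           | reflect-or-long α∈Φ β∈Φ (<-respʳ-≈ (⟨⟩-sym α β) 0<αβ)
      ... | inj₁ α-β∈Φ | _          = α-β∈Φ
      ... | inj₂ _     | inj₁ β-α∈Φ = -ᴹ-swap-root β-α∈Φ
      ... | inj₂ ββ≤αβ | inj₂ αα≤βα =
        contradiction (⟨⟩-pos (-ᴹ-nonzero α≉β)) (≤⇒≯ (begin
          ⟨ α -ᴹ β , α -ᴹ β ⟩
            ≈⟨ ⟨⟩--ˡ α β _ ⟩
          ⟨ α , α -ᴹ β ⟩ - ⟨ β , α -ᴹ β ⟩
            ≈⟨ +-cong (⟨⟩-sym α _) (-‿cong (⟨⟩-sym β _)) ⟩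
          ⟨ α -ᴹ β , α ⟩ - ⟨ α -ᴹ β , β ⟩
            ≈⟨ +-cong (⟨⟩--ˡ α β α) (-‿cong (⟨⟩--ˡ α β β)) ⟩
          (⟨ α , α ⟩ - ⟨ β , α ⟩) - (⟨ α , β ⟩ - ⟨ β , β ⟩)
            ≈⟨ solve 4 (λ aa ba ab bb → (aa :- ba) :- (ab :- bb) := (aa :+ bb) :- (ba :+ ab))
                 refl _ _ _ _ ⟩
          (⟨ α , α ⟩ + ⟨ β , β ⟩) - (⟨ β , α ⟩ + ⟨ α , β ⟩)
            ≤⟨ +-monoˡ-≤ _ (+-mono-≤ αα≤βα ββ≤αβ) ⟩
          (⟨ β , α ⟩ + ⟨ α , β ⟩) - (⟨ β , α ⟩ + ⟨ α , β ⟩)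
            ≈⟨ -‿inverseʳ _ ⟩
          0# ∎))
        where open ≤-Reasoning

    -- Being joined to γ by a common non-orthogonal root is a closed condition:
    -- if α is joined to γ through δ, β is not joined to γ, and ⟨ α , β ⟩ ≠ 0,
    -- then reflect α δ joins β to γ.
    module _ (irreducible : Irreducible Φ) {γ} (γ∈Φ : γ ∈ Φ) where
      private
        Joins : Carrierᴹ → Pred Carrierᴹ ℓ
        Joins α δ = ⟨ δ , γ ⟩ ≉ 0# × ⟨ δ , α ⟩ ≉ 0#

        Joins? : ∀ α δ → Dec (Joins α δ)
        Joins? α δ = ¬? (⟨ δ , γ ⟩ ≟ 0#) ×-dec ¬? (⟨ δ , α ⟩ ≟ 0#)

        Joined : Pred Carrierᴹ _
        Joined α = Any (Joins α) Φ

        Joined? : ∀ α → Dec (Joined α)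
        Joined? α = any? (Joins? α) Φ

        Joined-resp : ∀ {α β} → α ≈ᴹ β → Joined α → Joined β
        Joined-resp α≈β = Any.map λ (δγ , δα) → δγ , δα ∘ trans (⟨⟩-congʳ _ α≈β)

        Joined-∈ : ∀ {α δ} → δ ∈ Φ → ⟨ δ , γ ⟩ ≉ 0# → ⟨ δ , α ⟩ ≉ 0# → Joined α
        Joined-∈ δ∈Φ δγ δα = Any.map (λ δ≈ →
          δγ ∘ trans (⟨⟩-congˡ _ δ≈) , δα ∘ trans (⟨⟩-congˡ _ δ≈)) δ∈Φ

        ∈-Joined : ∀ {α} → Joined α → ∃[ δ ] (δ ∈ Φ × Joins α δ)
        ∈-Joined = SetoidMembership.find setoidᴹ

        Joined-closed : ∀ {α β} → α ∈ Φ → Joined α → ¬ Joined β → ⟨ α , β ⟩ ≈ 0#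
        Joined-closed {α} {β} α∈Φ α-joined β-not-joined with ∈-Joined α-joined
        ... | δ , δ∈Φ , δγ , δα with ⟨ α , β ⟩ ≟ 0# | ⟨ δ , β ⟩ ≟ 0# | ⟨ α , γ ⟩ ≟ 0#
        ... | yes αβ≈0 | _ | _ = αβ≈0
        -- `δ` or `α` itself may join `β` to `γ`. Otherwise `α` is orthogonal to `γ`, so the
        -- reflection keeps the pairing of `δ` with `γ`, while the pairing with `β` becomes minus
        -- the nonzero `cartan δ α * ⟨ α , β ⟩`.
        ... | no αβ≉0 | no δβ≉0 | _ = contradiction (Joined-∈ δ∈Φ δγ δβ≉0) β-not-joined
        ... | no αβ≉0 | yes _ | no αγ≉0 = contradiction (Joined-∈ α∈Φ αγ≉0 αβ≉0) β-not-joined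
        ... | no αβ≉0 | yes δβ≈0 | yes αγ≈0 = contradiction
          (Joined-∈ (reflection α∈Φ δ∈Φ)
            (δγ ∘ trans (sym (⟨⟩-reflect-⊥ δ αγ≈0)))
            λ r≈0 → αβ≉0 (x*y≈0∧x≉0⇒y≈0 (cβ≈0 r≈0) c≉0))
          β-not-joined
          where
          c≉0 : cartan δ α ≉ 0#
          c≉0 c≈0 = δα (x*y≈0∧x≉0⇒y≈0
            (trans (sym (cartan-norm δ α∈Φ)) (trans (*-congˡ c≈0) (zeroʳ _)))
            (<⇒≉ 0<2 ∘ sym))
          cβ≈0 : ⟨ reflect α δ , β ⟩ ≈ 0# → cartan δ α * ⟨ α , β ⟩ ≈ 0#
          cβ≈0 r≈0 = begin
            cartan δ α * ⟨ α , β ⟩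
              ≈⟨ solve 2 (λ d x → x := d :- (d :- x)) refl ⟨ δ , β ⟩ _ ⟩
            ⟨ δ , β ⟩ - (⟨ δ , β ⟩ - cartan δ α * ⟨ α , β ⟩)
              ≈⟨ +-cong δβ≈0 (-‿cong (trans (sym (⟨⟩-reflect α δ β)) r≈0)) ⟩
            0# - 0#
              ≈⟨ -‿inverseʳ 0# ⟩
            0# ∎
            where open ≈-Reasoning setoid

      -- If `γ′` were not joined to `γ`, the joined roots and the others would split `Φ` into
      -- orthogonal parts: `γ` lies in the first, being joined to itself through `γ`, and `γ′` in
      -- the second.
      common-neighbour : ∀ {γ′} → γ′ ∈ Φ → ∃[ δ ] (δ ∈ Φ × ⟨ δ , γ ⟩ ≉ 0# × ⟨ δ , γ′ ⟩ ≉ 0#)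
      common-neighbour {γ′} γ′∈Φ with Joined? γ′
      ... | yes joined = ∈-Joined joined
      ... | no ¬joined = contradiction
        ( filter Joined? Φ , filter (¬? ∘ Joined?) Φ
        , nonempty (∈-filter⁺ setoidᴹ Joined? Joined-resp γ∈Φ
            (Joined-∈ γ∈Φ (root-≉0 γ∈Φ) (root-≉0 γ∈Φ)))
        , nonempty (∈-filter⁺ setoidᴹ (¬? ∘ Joined?) ¬Joined-resp γ′∈Φ ¬joined)
        , (λ x → mk⇔ split [ proj₁ ∘ ∈-filter⁻ setoidᴹ Joined? Joined-resp
                           , proj₁ ∘ ∈-filter⁻ setoidᴹ (¬? ∘ Joined?) ¬Joined-resp ]′)
        , λ α β α∈ β∈ → let α∈Φ , α-joined = ∈-filter⁻ setoidᴹ Joined? Joined-resp α∈ in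
            Joined-closed α∈Φ α-joined
              (proj₂ (∈-filter⁻ setoidᴹ (¬? ∘ Joined?) ¬Joined-resp {xs = Φ} β∈)))
        (proj₂ irreducible)
        where
        ¬Joined-resp : ∀ {α β} → α ≈ᴹ β → ¬ Joined α → ¬ Joined β
        ¬Joined-resp α≈β ¬α = ¬α ∘ Joined-resp (≈ᴹ-sym α≈β)
        nonempty : ∀ {x xs} → x ∈ xs → xs ≢ []
        nonempty () ≡.refl
        split : ∀ {x} → x ∈ Φ → x ∈ filter Joined? Φ ⊎ x ∈ filter (¬? ∘ Joined?) Φ
        split {x} x∈Φ with Joined? x
        ... | yes j = inj₁ (∈-filter⁺ setoidᴹ Joined? Joined-resp x∈Φ j)
        ... | no ¬j = inj₂ (∈-filter⁺ setoidᴹ (¬? ∘ Joined?) ¬Joined-resp x∈Φ ¬j)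

    -- A negative pairing with `γ` is corrected by reflecting in `γ`, which reverses it;
    -- orthogonality of `γ` and `γ′` preserves the pairing with `γ′`. Two such corrections, one for
    -- each root, do not interfere.
    make-positive : ∀ {γ γ′ δ} → γ ∈ Φ → ⟨ γ , γ′ ⟩ ≈ 0# → δ ∈ Φ → ⟨ δ , γ ⟩ ≉ 0# →
                    ∃[ α ] (α ∈ Φ × 0# < ⟨ α , γ ⟩ × ⟨ α , γ′ ⟩ ≈ ⟨ δ , γ′ ⟩)
    make-positive {γ} {γ′} {δ} γ∈Φ γ⊥γ′ δ∈Φ δγ≉0 with compare 0# ⟨ δ , γ ⟩
    ... | tri< 0<δγ _ _ = δ , δ∈Φ , 0<δγ , refl
    ... | tri≈ _ 0≈δγ _ = contradiction (sym 0≈δγ) δγ≉0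
    ... | tri> _ _ δγ<0 = reflect γ δ , reflection γ∈Φ δ∈Φ ,
      <-respʳ-≈ (sym (⟨⟩-reflect-self δ γ∈Φ)) (neg-pos δγ<0) , ⟨⟩-reflect-⊥ δ γ⊥γ′

    common-positive : Irreducible Φ → ∀ {γ γ′} → γ ∈ Φ → γ′ ∈ Φ → ⟨ γ , γ′ ⟩ ≈ 0# →
                      ∃[ α ] (α ∈ Φ × 0# < ⟨ α , γ ⟩ × 0# < ⟨ α , γ′ ⟩)
    common-positive irreducible {γ} {γ′} γ∈Φ γ′∈Φ γ⊥γ′ =
      let δ , δ∈Φ , δγ , δγ′ = common-neighbour irreducible γ∈Φ γ′∈Φ
          α , α∈Φ , 0<αγ , αγ′≈δγ′ = make-positive γ∈Φ γ⊥γ′ δ∈Φ δγ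
          β , β∈Φ , 0<βγ′ , βγ≈αγ = make-positive γ′∈Φ (trans (⟨⟩-sym γ′ γ) γ⊥γ′) α∈Φ
            (δγ′ ∘ trans (sym αγ′≈δγ′))
      in β , β∈Φ , <-respʳ-≈ (sym βγ≈αγ) 0<αγ , 0<βγ′

-- Roots on a face of the hull.

module Faces {c ℓ m ℓm f : Level} {ℝ : RealField c ℓ} (E : EuclideanSpace ℝ m ℓm) where
  open RealField ℝ hiding (zero)
  open OrderedField ℝ
  open EuclideanSpace E
  open Convexity E
  open RootSystems E
  open Euclidean E
  open Roots E
  open Extrema totalOrder
    using (argmax; argmin; argmax-all; argmin-all; f[xs]≤f[argmax]; f[argmin]≤f[xs])

  module Face
    (Φ : List Carrierᴹ) (rootSystem : IsRootSystem Φ)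
    (crystallographic : Crystallographic Φ) (reduced : Reduced Φ) (irreducible : Irreducible Φ)
    (F : Pred Carrierᴹ f) (face : IsFace (ConvexHull (_∈ Φ)) F) where
    open IsRootSystem rootSystem
    open RootSystem Φ rootSystem

    w : Carrierᴹ
    w = proj₁ face

    b : Carrier
    b = proj₁ (proj₂ face)

    w≉0 : w ≉ᴹ 0ᴹ
    w≉0 = proj₁ (proj₂ (proj₂ face))

    Top : Pred Carrierᴹ _
    Top = F ∩ (_∈ Φ)

    face⇒ : ∀ {x} → F x → ConvexHull (_∈ Φ) x × ⟨ x , w ⟩ ≈ b
    face⇒ {x} Fx =
      let x∈P , wx≈b = Equivalence.to (proj₂ (proj₂ (proj₂ (proj₂ face))) x) Fx
      in x∈P , trans (⟨⟩-sym x w) wx≈b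

    face⇐ : ∀ {x} → ConvexHull (_∈ Φ) x → ⟨ x , w ⟩ ≈ b → F x
    face⇐ {x} x∈P xw≈b =
      Equivalence.from (proj₂ (proj₂ (proj₂ (proj₂ face))) x) (x∈P , trans (⟨⟩-sym w x) xw≈b)

    root-≤ : ∀ {α} → α ∈ Φ → ⟨ α , w ⟩ ≤ b
    root-≤ {α} α∈Φ = ≤-respˡ (⟨⟩-sym w α)
      (proj₁ (proj₂ (proj₂ (proj₂ face))) α (∈⇒ConvexHull α∈Φ))

    top-height : ∀ {x} → Top x → ⟨ x , w ⟩ ≈ b
    top-height (Fx , _) = proj₂ (face⇒ Fx)

    mk-top : ∀ {x} → x ∈ Φ → ⟨ x , w ⟩ ≈ b → Top x
    mk-top x∈Φ xw≈b = face⇐ (∈⇒ConvexHull x∈Φ) xw≈b , x∈Φ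

    -- `F` is an arbitrary predicate, yet on roots it amounts to the decidable equation of height
    -- `b`.
    Top? : ∀ x → Dec (Top x)
    Top? x = map′ (λ (x∈Φ , xw≈b) → mk-top x∈Φ xw≈b) (λ x-top → proj₂ x-top , top-height x-top)
      (x ∈? Φ ×-dec ⟨ x , w ⟩ ≟ b)

    F-resp : ∀ {x y} → x ≈ᴹ y → F x → F y
    F-resp x≈y Fx = let x∈P , xw≈b = face⇒ Fx in
      face⇐ (ConvexHull-resp {S = _∈ Φ} x≈y x∈P) (trans (⟨⟩-congˡ w (≈ᴹ-sym x≈y)) xw≈b)

    Top-resp : ∀ {x y} → x ≈ᴹ y → Top x → Top y
    Top-resp x≈y (Fx , x∈Φ) = F-resp x≈y Fx , ∈-resp x≈y x∈Φ

    -- If `b ≤ 0`, the heights of `α` and `-ᴹ α` are both at most 0, so every root is orthogonal to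
    -- `w`; then so is `w` itself, a combination of roots, against `w ≉ᴹ 0ᴹ`.
    0<b : 0# < b
    0<b = ≰⇒> λ b≤0 →
      let n , p , a , p∈Φ , w≈ = spanning w
          height : ∀ {α} → α ∈ Φ → ⟨ α , w ⟩ ≈ 0#
          height {α} α∈Φ = ≤.antisym (≤.trans (root-≤ α∈Φ) b≤0)
            (≤-respˡ -0#≈0# (≤-respʳ (-‿involutive _) (neg-mono-≤ (≤.trans
              (≤-respˡ (⟨⟩-negˡ α w) (root-≤ (neg-root α∈Φ))) b≤0))))
      in w≉0 (⟨⟩-definite w (begin
        ⟨ w , w ⟩                     ≈⟨ ⟨⟩-congˡ w w≈ ⟩
        ⟨ linComb a p , w ⟩           ≈⟨ ⟨⟩-linComb a p w ⟩
        ∑ (λ i → a i * ⟨ p i , w ⟩)   ≈⟨ sum-cong-≋ (λ i → trans (*-congˡ (height (p∈Φ i))) (zeroʳ _)) ⟩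
        ∑ (λ (_ : Fin n) → 0#)        ≈⟨ sum-replicate-zero n ⟩
        0#                            ∎))
      where open ≈-Reasoning setoid

    -- A root below height `b` with positive weight would pull the average below `b`. Zero weights
    -- are kept, which avoids reindexing the combination.
    face-hull : ∀ {x} → F x → ∃[ n ] ∃[ p ] ∃[ a ]
                ((∀ (i : Fin n) → a i ≈ 0# ⊎ Top (p i)) ×
                 (∀ i → 0# ≤ a i) × ∑ a ≈ 1# × x ≈ᴹ linComb a p)
    face-hull Fx with face⇒ Fx
    ... | (n , p , a , p∈Φ , 0≤a , ∑a≈1 , x≈) , xw≈b =
      n , p , a , support , 0≤a , ∑a≈1 , x≈
      where
      support : ∀ i → a i ≈ 0# ⊎ Top (p i)
      support i = Sum.map₂ (mk-top (p∈Φ i))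
        (convex-≈ ∑a≈1 0≤a (λ j → inj₂ (root-≤ (p∈Φ j))) (trans (⟨⟩-congˡ w (≈ᴹ-sym x≈)) xw≈b) i)

    module _ {z k} (bounded : ∀ {y} → Top y → ⟨ y , z ⟩ ≤ k) where

      face-≤ : ∀ {x} → F x → ⟨ x , z ⟩ ≤ k
      face-≤ Fx =
        let n , p , a , support , 0≤a , ∑a≈1 , x≈ = face-hull Fx
        in ≤-respˡ (⟨⟩-congˡ z (≈ᴹ-sym x≈))
             (convex-≤ ∑a≈1 0≤a (λ i → Sum.map₂ bounded (support i)))

      -- Equality in the average leaves weight only on roots of `F` that attain `k`, and these all
      -- equal `v`.
      face-unique-max : ∀ {v} → (∀ {y} → Top y → ⟨ y , z ⟩ ≈ k → y ≈ᴹ v) →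
                        ∀ {x} → F x → ⟨ x , z ⟩ ≈ k → x ≈ᴹ v
      face-unique-max {v} unique Fx xz≈k =
        let n , p , a , support , 0≤a , ∑a≈1 , x≈ = face-hull Fx
            max = convex-≈ ∑a≈1 0≤a (λ i → Sum.map₂ bounded (support i))
                    (trans (⟨⟩-congˡ z (≈ᴹ-sym x≈)) xz≈k)
        in ≈ᴹ-trans x≈ (linComb-const ∑a≈1 λ i → both (support i) (max i))
        where
        both : ∀ {aᵢ y} → aᵢ ≈ 0# ⊎ Top y → aᵢ ≈ 0# ⊎ ⟨ y , z ⟩ ≈ k → aᵢ ≈ 0# ⊎ y ≈ᴹ v
        both (inj₁ aᵢ≈0)  _           = inj₁ aᵢ≈0
        both (inj₂ _)     (inj₁ aᵢ≈0) = inj₁ aᵢ≈0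
        both (inj₂ y-top) (inj₂ yz≈k) = inj₂ (unique y-top yz≈k)

    -- Weights with sum 1 cannot all vanish, and a root whose weight does not vanish lies in `F`.
    top-exists : ∀ {x} → F x → ∃[ y ] Top y
    top-exists Fx with face-hull Fx
    ... | n , p , a , support , _ , ∑a≈1 , _ = search n a support ∑a≈1
      where
      search : ∀ n (a : Vector Carrier n) {p : Vector Carrierᴹ n} →
               (∀ i → a i ≈ 0# ⊎ Top (p i)) → ∑ a ≈ 1# → ∃[ y ] Top y
      search zero    a support ∑a≈1 = contradiction ∑a≈1 (<⇒≉ 0<1)
      search (suc n) a support ∑a≈1 with support zero
      ... | inj₂ p₀-top = _ , p₀-top
      ... | inj₁ a₀≈0   = search n (a ∘ suc) (support ∘ suc)
        (trans (sym (trans (+-congʳ a₀≈0) (+-identityˡ _))) ∑a≈1)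

    -- If ⟨ x , y ⟩ < 0 then x + y would be a root of height 2 b.
    top-acute : ∀ {x y} → Top x → Top y → 0# ≤ ⟨ x , y ⟩
    top-acute {x} {y} x-top y-top with compare 0# ⟨ x , y ⟩
    ... | tri< 0<xy _ _ = <⇒≤ 0<xy
    ... | tri≈ _ 0≈xy _ = ≤-reflexive 0≈xy
    ... | tri> _ _ xy<0 = contradiction
      (<-respˡ-≈ (+-identityʳ b) (+-monoʳ-< b 0<b))
      (≤⇒≯ (≤-respˡ height (root-≤ (difference-root crystallographic (proj₂ x-top)
        (neg-root (proj₂ y-top)) x≉-y 0<x-y))))
      where
      x≉-y : x ≉ᴹ -ᴹ y
      x≉-y x≈-y = irrefl refl (begin-strict
        0#              <⟨ 0<b ⟩
        b               ≈⟨ top-height x-top ⟨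
        ⟨ x , w ⟩       ≈⟨ ⟨⟩-congˡ w x≈-y ⟩
        ⟨ -ᴹ y , w ⟩    ≈⟨ ⟨⟩-negˡ y w ⟩
        - ⟨ y , w ⟩     ≈⟨ -‿cong (top-height y-top) ⟩
        - b             ≤⟨ ≤-respʳ -0#≈0# (neg-mono-≤ (<⇒≤ 0<b)) ⟩
        0#              ∎)
        where open ≤-Reasoning
      0<x-y : 0# < ⟨ x , -ᴹ y ⟩
      0<x-y = <-respʳ-≈ (trans (-‿cong (⟨⟩-sym x y)) (trans (sym (⟨⟩-negˡ y x)) (⟨⟩-sym _ x)))
        (neg-pos xy<0)
      height : ⟨ x -ᴹ (-ᴹ y) , w ⟩ ≈ b + b
      height = begin
        ⟨ x -ᴹ (-ᴹ y) , w ⟩         ≈⟨ ⟨⟩-congˡ w (+ᴹ-congˡ (+ᴹ.⁻¹-involutive y)) ⟩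
        ⟨ x +ᴹ y , w ⟩              ≈⟨ ⟨⟩-+ˡ x y w ⟩
        ⟨ x , w ⟩ + ⟨ y , w ⟩       ≈⟨ +-cong (top-height x-top) (top-height y-top) ⟩
        b + b                       ∎
        where open ≈-Reasoning setoid

    -- Reflecting a root α with ⟨ α , x ⟩ , ⟨ α , y ⟩ > 0 in both x and y gives a
    -- root of height at most ⟨ α , w ⟩ - 2 b, which forces α onto the face.
    top-bridge : ∀ {x y} → Top x → Top y → ⟨ x , y ⟩ ≈ 0# →
                 ∃[ α ] (Top α × 0# < ⟨ α , x ⟩ × 0# < ⟨ α , y ⟩)
    top-bridge {x} {y} x-top y-top x⊥y
      with common-positive irreducible (proj₂ x-top) (proj₂ y-top) x⊥y
    ... | α , α∈Φ , 0<αx , 0<αy = α , mk-top α∈Φ αw≈b , 0<αx , 0<αy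
      where
      x∈Φ = proj₂ x-top
      y∈Φ = proj₂ y-top
      α₁ = reflect x α
      α₁∈Φ = reflection x∈Φ α∈Φ
      α₂∈Φ = reflection y∈Φ α₁∈Φ
      c₁ = cartan α x
      c₂ = cartan α₁ y
      h = ⟨ α , w ⟩
      1≤c₁ : 1# ≤ c₁
      1≤c₁ = 1≤cartan crystallographic x∈Φ α∈Φ 0<αx
      1≤c₂ : 1# ≤ c₂
      1≤c₂ = 1≤cartan crystallographic y∈Φ α₁∈Φ (<-respʳ-≈ (sym (⟨⟩-reflect-⊥ α x⊥y)) 0<αy)
      height : ⟨ -ᴹ reflect y α₁ , w ⟩ ≈ - (h - c₁ * b - c₂ * b)
      height = begin
        ⟨ -ᴹ reflect y α₁ , w ⟩         ≈⟨ ⟨⟩-negˡ _ w ⟩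
        - ⟨ reflect y α₁ , w ⟩          ≈⟨ -‿cong (⟨⟩-reflect y α₁ w) ⟩
        - (⟨ α₁ , w ⟩ - c₂ * ⟨ y , w ⟩) ≈⟨ -‿cong (+-cong (⟨⟩-reflect x α w)
                                             (-‿cong (*-congˡ (top-height y-top)))) ⟩
        - (h - c₁ * ⟨ x , w ⟩ - c₂ * b) ≈⟨ -‿cong (+-congʳ (+-congˡ (-‿cong
                                             (*-congˡ (top-height x-top))))) ⟩
        - (h - c₁ * b - c₂ * b)         ∎
        where open ≈-Reasoning setoid
      αw≈b : h ≈ b
      -- `h - b` is a sum of three nonnegative terms: the negative of the twice reflected root has
      -- height at most `b`, and both Cartan integers are at least 1.
      αw≈b = ≤.antisym (root-≤ α∈Φ) (0≤y-x⇒x≤y (≤-respʳ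
        (solve 4 (λ h b c₁ c₂ →
          (b :- (:- (h :- c₁ :* b :- c₂ :* b))) :+
          (b :* (c₁ :- con (+ 1)) :+ b :* (c₂ :- con (+ 1))) := h :- b) refl h b c₁ c₂)
        (+-nonNeg (x≤y⇒0≤y-x (≤-respˡ height (root-≤ (neg-root α₂∈Φ))))
          (+-nonNeg (*-nonNeg (<⇒≤ 0<b) (x≤y⇒0≤y-x 1≤c₁))
                    (*-nonNeg (<⇒≤ 0<b) (x≤y⇒0≤y-x 1≤c₂))))))

    -- The extreme roots and what lies between them.

    -- The common interface of two sources, the roots found by maximising along the line and the
    -- given vertices of `F`, so that one classification serves both.
    record Ends (g g′ : Carrierᴹ) : Set (c ⊔ ℓ ⊔ m ⊔ ℓm ⊔ f) where
      field
        top     : Top g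
        top′    : Top g′
        g≉g′    : g ≉ᴹ g′
        segment : ∀ {x} → Top x → Segment g g′ x

    Ends-sym : ∀ {g g′} → Ends g g′ → Ends g′ g
    Ends-sym ends = record
      { top = top′ ; top′ = top ; g≉g′ = g≉g′ ∘ ≈ᴹ-sym ; segment = Segment-sym ∘ segment }
      where open Ends ends

    Ends-cong : ∀ {g g′ h h′} → g ≈ᴹ h → g′ ≈ᴹ h′ → Ends g g′ → Ends h h′
    Ends-cong g≈h g′≈h′ ends = record
      { top     = Top-resp g≈h top
      ; top′    = Top-resp g′≈h′ top′
      ; g≉g′    = λ h≈h′ → g≉g′ (≈ᴹ-trans g≈h (≈ᴹ-trans h≈h′ (≈ᴹ-sym g′≈h′)))
      ; segment = Segment-cong g≈h g′≈h′ ∘ segment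
      }
      where open Ends ends

    module Classify {g g′} (ends : Ends g g′) where
      open Ends ends

      β : Carrierᴹ
      β = g -ᴹ g′

      Interior : Pred Carrierᴹ _
      Interior x = Top x × x ≉ᴹ g × x ≉ᴹ g′

      -- With `s` and `t` positive, `⟨ x , g ⟩` is a positive multiple of `⟨ g , g ⟩` plus a term
      -- that `top-acute` makes nonnegative, and likewise for `g′`; so `difference-root` applies to
      -- both pairs.
      interior-differences : ∀ {x} → Interior x → g -ᴹ x ∈ Φ × x -ᴹ g′ ∈ Φ
      interior-differences {x} (x-top , x≉g , x≉g′) with segment x-top
      ... | s , t , 0≤s , 0≤t , s+t≈1 , x≈ =
        -ᴹ-swap-root (difference-root crystallographic (proj₂ x-top) (proj₂ top) x≉g
          (<-respʳ-≈ (sym (⟨⟩-point g))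
            (+-pos-nonNeg (*-pos 0<s (root-pos (proj₂ top)))
                          (*-nonNeg 0≤t (top-acute top′ top))))) ,
        difference-root crystallographic (proj₂ x-top) (proj₂ top′) x≉g′
          (<-respʳ-≈ (trans (+-comm _ _) (sym (⟨⟩-point g′)))
            (+-pos-nonNeg (*-pos 0<t (root-pos (proj₂ top′)))
                          (*-nonNeg 0≤s (top-acute top top′))))
        where
        open OnLine s+t≈1 x≈
        0<s = ≤∧≉⇒< 0≤s (x≉g′ ∘ s≈0⇒x≈g′ ∘ sym)
        0<t = ≤∧≉⇒< 0≤t (x≉g ∘ t≈0⇒x≈g ∘ sym)

      interior-midpoint : ∀ {x} → Interior x → g -ᴹ x ≈ᴹ x -ᴹ g′
      interior-midpoint {x} x-int@(x-top , x≉g , x≉g′) with segment x-top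
      ... | s , t , 0≤s , 0≤t , s+t≈1 , x≈ =
        -- Reducedness leaves 1 and -1 for the ratio `t * s ⁻¹` of the two proportional roots; it is
        -- nonnegative, which rules out -1.
        [ (λ t/s≈1 → ≈ᴹ-trans (≈ᴹ-sym ratio) (≈ᴹ-trans (*ₗ-congʳ t/s≈1) (*ₗ-identityˡ _)))
        , (λ t/s≈-1 → contradiction t/s≈-1 (nonNeg⇒≉-1 (*-nonNeg 0≤t (<⇒≤ (⁻¹-pos 0<s)))))
        ]′ (reduced (t * s ⁻¹) (proj₂ (interior-differences x-int))
             (∈-resp (≈ᴹ-sym ratio) (proj₁ (interior-differences x-int))))
        where
        open OnLine s+t≈1 x≈
        s≉0 = x≉g′ ∘ s≈0⇒x≈g′
        0<s = ≤∧≉⇒< 0≤s (s≉0 ∘ sym)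
        ratio = t/s-scaled s≉0

      nonorthogonal⇒difference : ⟨ g , g′ ⟩ ≉ 0# → β ∈ Φ
      nonorthogonal⇒difference gg′≉0 =
        difference-root crystallographic (proj₂ top) (proj₂ top′) g≉g′
          (≤∧≉⇒< (top-acute top top′) (gg′≉0 ∘ sym))

      -- The root `x -ᴹ g′` is `s` times the root `β`, so `s` is 1 and `x` is `g`.
      difference⇒no-interior : β ∈ Φ → ∀ {x} → ¬ Interior x
      difference⇒no-interior β∈Φ {x} x-int@(x-top , x≉g , x≉g′) with segment x-top
      ... | s , t , 0≤s , 0≤t , s+t≈1 , x≈ =
        [ (λ s≈1 → x≉g (t≈0⇒x≈g (+-identityʳ-unique s t (trans s+t≈1 (sym s≈1)))))
        , (λ s≈-1 → contradiction s≈-1 (nonNeg⇒≉-1 0≤s))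
        ]′ (reduced s β∈Φ (∈-resp right (proj₂ (interior-differences x-int))))
        where open OnLine s+t≈1 x≈

      -- The root of `top-bridge` pairs positively with both ends, while each end is orthogonal to
      -- the other; hence it is neither.
      orthogonal⇒interior : ⟨ g , g′ ⟩ ≈ 0# → ∃[ x ] Interior x
      orthogonal⇒interior g⊥g′ =
        let x , x-top , 0<xg , 0<xg′ = top-bridge top top′ g⊥g′ in
        x , x-top ,
        (λ x≈g → <⇒≉ 0<xg′ (sym (trans (⟨⟩-congˡ g′ x≈g) g⊥g′))) ,
        (λ x≈g′ → <⇒≉ 0<xg (sym (trans (⟨⟩-congˡ g x≈g′) (trans (⟨⟩-sym g′ g) g⊥g′))))

      interior-doubled : ∀ {x} → Interior x → ∀ z →
                         ⟨ x , z ⟩ + ⟨ x , z ⟩ ≈ ⟨ g , z ⟩ + ⟨ g′ , z ⟩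
      interior-doubled {x} x-int z = begin
        ⟨ x , z ⟩ + ⟨ x , z ⟩
          ≈⟨ solve 2 (λ x g′ → x :+ x := (x :- g′) :+ (x :+ g′)) refl _ _ ⟩
        (⟨ x , z ⟩ - ⟨ g′ , z ⟩) + (⟨ x , z ⟩ + ⟨ g′ , z ⟩)
          ≈⟨ +-congʳ (trans (sym (⟨⟩--ˡ x g′ z)) (trans
               (⟨⟩-congˡ z (≈ᴹ-sym (interior-midpoint x-int))) (⟨⟩--ˡ g x z))) ⟩
        (⟨ g , z ⟩ - ⟨ x , z ⟩) + (⟨ x , z ⟩ + ⟨ g′ , z ⟩)
          ≈⟨ solve 3 (λ x g g′ → (g :- x) :+ (x :+ g′) := g :+ g′) refl _ _ _ ⟩
        ⟨ g , z ⟩ + ⟨ g′ , z ⟩ ∎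
        where open ≈-Reasoning setoid

      interior-unique : ∀ {x y} → Interior x → Interior y → x ≈ᴹ y
      interior-unique {x} {y} x-int y-int = ⟨⟩-ext λ z → *-cancelˡ-≉0 (<⇒≉ 0<2 ∘ sym) (begin
        (1# + 1#) * ⟨ x , z ⟩     ≈⟨ double _ ⟩
        ⟨ x , z ⟩ + ⟨ x , z ⟩     ≈⟨ interior-doubled x-int z ⟩
        ⟨ g , z ⟩ + ⟨ g′ , z ⟩    ≈⟨ interior-doubled y-int z ⟨
        ⟨ y , z ⟩ + ⟨ y , z ⟩     ≈⟨ double _ ⟨
        (1# + 1#) * ⟨ y , z ⟩     ∎)
        where
        open ≈-Reasoning setoid
        double : ∀ u → (1# + 1#) * u ≈ u + u
        double u = solve 1 (λ u → con (+ 2) :* u := u :+ u) refl u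

      -- If `x` were at least as long as both ends, |g|² + |g′|² would be at most 2 |x|²; one end is
      -- therefore the longer root that `IsShort` asks for.
      interior-short : ⟨ g , g′ ⟩ ≈ 0# → ∀ {x} → Interior x → IsShort Φ x
      interior-short g⊥g′ {x} x-int@((_ , x∈Φ) , _) =
        x∈Φ , [ (λ xx<gg → g , proj₂ top , xx<gg)
              , (λ gg≤xx → [ (λ xx<g′g′ → g′ , proj₂ top′ , xx<g′g′)
                           , (λ g′g′≤xx → contradiction too-long (≤⇒≯ (+-mono-≤ gg≤xx g′g′≤xx)))
                           ]′ (<-or-≥ ⟨ x , x ⟩ ⟨ g′ , g′ ⟩))
              ]′ (<-or-≥ ⟨ x , x ⟩ ⟨ g , g ⟩)
        where
        -- |g|² + |g′|² = 4 |x|², since 2 x = g + g′ and g ⊥ g′.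
        too-long : ⟨ x , x ⟩ + ⟨ x , x ⟩ < ⟨ g , g ⟩ + ⟨ g′ , g′ ⟩
        too-long = begin-strict
          ⟨ x , x ⟩ + ⟨ x , x ⟩
            ≈⟨ +-identityʳ _ ⟨
          ⟨ x , x ⟩ + ⟨ x , x ⟩ + 0#
            <⟨ +-monoʳ-< _ (+-pos-nonNeg (root-pos x∈Φ) (<⇒≤ (root-pos x∈Φ))) ⟩
          ⟨ x , x ⟩ + ⟨ x , x ⟩ + (⟨ x , x ⟩ + ⟨ x , x ⟩)
            ≈⟨ +-cong (interior-doubled x-int x) (interior-doubled x-int x) ⟩
          ⟨ g , x ⟩ + ⟨ g′ , x ⟩ + (⟨ g , x ⟩ + ⟨ g′ , x ⟩)
            ≈⟨ +-cong (+-cong (⟨⟩-sym g x) (⟨⟩-sym g′ x)) (+-cong (⟨⟩-sym g x) (⟨⟩-sym g′ x)) ⟩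
          ⟨ x , g ⟩ + ⟨ x , g′ ⟩ + (⟨ x , g ⟩ + ⟨ x , g′ ⟩)
            ≈⟨ solve 2 (λ a b → (a :+ b) :+ (a :+ b) := (a :+ a) :+ (b :+ b)) refl _ _ ⟩
          ⟨ x , g ⟩ + ⟨ x , g ⟩ + (⟨ x , g′ ⟩ + ⟨ x , g′ ⟩)
            ≈⟨ +-cong (interior-doubled x-int g) (interior-doubled x-int g′) ⟩
          ⟨ g , g ⟩ + ⟨ g′ , g ⟩ + (⟨ g , g′ ⟩ + ⟨ g′ , g′ ⟩)
            ≈⟨ +-cong (+-congˡ (trans (⟨⟩-sym g′ g) g⊥g′)) (+-congʳ g⊥g′) ⟩
          ⟨ g , g ⟩ + 0# + (0# + ⟨ g′ , g′ ⟩)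
            ≈⟨ +-cong (+-identityʳ _) (+-identityˡ _) ⟩
          ⟨ g , g ⟩ + ⟨ g′ , g′ ⟩ ∎
          where open ≤-Reasoning

    Alternatives : Carrierᴹ → Carrierᴹ → Set _
    Alternatives γ γ′ =
      ( ¬ (⟨ γ , γ′ ⟩ ≈ 0#)
      × (∀ x → Top x ⇔ (x ≈ᴹ γ ⊎ x ≈ᴹ γ′))
      × (γ -ᴹ γ′) ∈ Φ )
      ⊎
      ( ⟨ γ , γ′ ⟩ ≈ 0#
      × (∃[ γ″ ]
          ( γ″ ≉ᴹ γ × γ″ ≉ᴹ γ′
          × (∀ x → Top x ⇔ (x ≈ᴹ γ ⊎ x ≈ᴹ γ′ ⊎ x ≈ᴹ γ″))
          × IsShort Φ γ″
          × γ -ᴹ γ″ ≈ᴹ γ″ -ᴹ γ′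
          × (γ -ᴹ γ″) ∈ Φ ))
      × (∃[ δ ] (δ ∈ Φ × γ -ᴹ γ′ ≈ᴹ (1# + 1#) *ₗ δ)) )

    ends⇒alternatives : ∀ {g g′} → Ends g g′ → Alternatives g g′
    ends⇒alternatives {g} {g′} ends with ⟨ g , g′ ⟩ ≟ 0#
    ... | no gg′≉0 = inj₁ (gg′≉0 , (λ x → mk⇔ end only-ends) , β∈Φ)
      where
      open Ends ends
      open Classify ends
      β∈Φ = nonorthogonal⇒difference gg′≉0
      end : ∀ {x} → Top x → x ≈ᴹ g ⊎ x ≈ᴹ g′
      end {x} x-top with x ≟ᴹ g | x ≟ᴹ g′
      ... | yes x≈g | _        = inj₁ x≈g
      ... | no _    | yes x≈g′ = inj₂ x≈g′
      ... | no x≉g  | no x≉g′  =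
        contradiction (x-top , x≉g , x≉g′) (difference⇒no-interior β∈Φ)
      only-ends : ∀ {x} → x ≈ᴹ g ⊎ x ≈ᴹ g′ → Top x
      only-ends = [ (λ x≈g → Top-resp (≈ᴹ-sym x≈g) top) , (λ x≈g′ → Top-resp (≈ᴹ-sym x≈g′) top′) ]′
    ... | yes g⊥g′ = inj₂
      ( g⊥g′
      , (x , proj₁ (proj₂ x-int) , proj₂ (proj₂ x-int) , (λ y → mk⇔ cases roots)
        , interior-short g⊥g′ x-int , interior-midpoint x-int , δ∈Φ)
      , g -ᴹ x , δ∈Φ , twice)
      where
      open Ends ends
      open Classify ends
      x = proj₁ (orthogonal⇒interior g⊥g′)
      x-int = proj₂ (orthogonal⇒interior g⊥g′)
      δ∈Φ = proj₁ (interior-differences x-int)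
      cases : ∀ {y} → Top y → y ≈ᴹ g ⊎ y ≈ᴹ g′ ⊎ y ≈ᴹ x
      cases {y} y-top with y ≟ᴹ g | y ≟ᴹ g′
      ... | yes y≈g | _        = inj₁ y≈g
      ... | no _    | yes y≈g′ = inj₂ (inj₁ y≈g′)
      ... | no y≉g  | no y≉g′  = inj₂ (inj₂ (interior-unique (y-top , y≉g , y≉g′) x-int))
      roots : ∀ {y} → y ≈ᴹ g ⊎ y ≈ᴹ g′ ⊎ y ≈ᴹ x → Top y
      roots (inj₁ y≈g)         = Top-resp (≈ᴹ-sym y≈g) top
      roots (inj₂ (inj₁ y≈g′)) = Top-resp (≈ᴹ-sym y≈g′) top′
      roots (inj₂ (inj₂ y≈x))  = Top-resp (≈ᴹ-sym y≈x) (proj₁ x-int)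
      twice : g -ᴹ g′ ≈ᴹ (1# + 1#) *ₗ (g -ᴹ x)
      twice = ⟨⟩-ext λ z → begin
        ⟨ g -ᴹ g′ , z ⟩
          ≈⟨ ⟨⟩--ˡ g g′ z ⟩
        ⟨ g , z ⟩ - ⟨ g′ , z ⟩
          ≈⟨ solve 2 (λ g g′ → g :- g′ := con (+ 2) :* g :- (g :+ g′)) refl _ _ ⟩
        (1# + 1#) * ⟨ g , z ⟩ - (⟨ g , z ⟩ + ⟨ g′ , z ⟩)
          ≈⟨ +-congˡ (-‿cong (interior-doubled x-int z)) ⟨
        (1# + 1#) * ⟨ g , z ⟩ - (⟨ x , z ⟩ + ⟨ x , z ⟩)
          ≈⟨ solve 2 (λ g x → con (+ 2) :* g :- (x :+ x) := con (+ 2) :* (g :- x)) refl _ _ ⟩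
        (1# + 1#) * (⟨ g , z ⟩ - ⟨ x , z ⟩)
          ≈⟨ *-congˡ (⟨⟩--ˡ g x z) ⟨
        (1# + 1#) * ⟨ g -ᴹ x , z ⟩
          ≈⟨ ⟨⟩-*ˡ _ _ z ⟨
        ⟨ (1# + 1#) *ₗ (g -ᴹ x) , z ⟩ ∎
        where open ≈-Reasoning setoid

    -- String, count and vertices.

    module _ {g g′} (top : Top g) (top′ : Top g′) where

      differences-level : ∀ {x y} → Top x → Top y → ⟨ x -ᴹ y , w ⟩ ≈ 0#
      differences-level x-top y-top = trans (⟨⟩--ˡ _ _ w)
        (trans (+-cong (top-height x-top) (-‿cong (top-height y-top))) (-‿inverseʳ b))

      -- A step of height 0 keeps the whole string at height `b`, so no root of the string through
      -- `y` lies off `F`.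
      string⇒top : ∀ {x y δ} → Top y → ⟨ δ , w ⟩ ≈ 0# → rootString Φ δ y x → Top x
      string⇒top y-top δw≈0 ((n , x≈) , x∈Φ) = mk-top x∈Φ
        (trans (⟨⟩-congˡ w x≈) (trans (⟨⟩-+*ˡ _ (fromℤ n) _ w)
          (trans (+-cong (top-height y-top) (trans (*-congˡ δw≈0) (zeroʳ _))) (+-identityʳ b))))

      alternatives⇒string : Alternatives g g′ → RootsFormString Φ F
      alternatives⇒string (inj₁ (_ , tops , β∈Φ)) =
        -- The string is based at `g′`, so its roots sit at positions 0 and 1; with a midpoint `γ`
        -- the step is `g -ᴹ γ` and the positions are 0, 1 and 2.
        g -ᴹ g′ , g′ , β∈Φ , top′ , λ x → mk⇔
          (λ x-top → position (Equivalence.to (tops x) x-top) , proj₂ x-top)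
          (string⇒top top′ (differences-level top top′))
        where
        position : ∀ {x} → x ≈ᴹ g ⊎ x ≈ᴹ g′ → ∃[ n ] (x ≈ᴹ g′ +ᴹ fromℤ n *ₗ (g -ᴹ g′))
        position (inj₁ x≈g)  = + 1 , ≈ᴹ-trans x≈g (step-1 ≈ᴹ-refl)
        position (inj₂ x≈g′) = + 0 , ≈ᴹ-trans x≈g′ (step-0 _ _)
      alternatives⇒string (inj₂ (_ , (γ , _ , _ , tops , _ , g-γ≈γ-g′ , δ∈Φ) , _)) =
        g -ᴹ γ , g′ , δ∈Φ , top′ , λ x → mk⇔
          (λ x-top → position (Equivalence.to (tops x) x-top) , proj₂ x-top)
          (string⇒top top′ (differences-level top (Equivalence.from (tops γ) (inj₂ (inj₂ ≈ᴹ-refl)))))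
        where
        position : ∀ {x} → x ≈ᴹ g ⊎ x ≈ᴹ g′ ⊎ x ≈ᴹ γ → ∃[ n ] (x ≈ᴹ g′ +ᴹ fromℤ n *ₗ (g -ᴹ γ))
        position (inj₁ x≈g)         = + 2 , ≈ᴹ-trans x≈g (step-2 ≈ᴹ-refl g-γ≈γ-g′)
        position (inj₂ (inj₁ x≈g′)) = + 0 , ≈ᴹ-trans x≈g′ (step-0 _ _)
        position (inj₂ (inj₂ x≈γ))  = + 1 , ≈ᴹ-trans x≈γ (step-1 g-γ≈γ-g′)

      alternatives⇒cardinality : g ≉ᴹ g′ → Alternatives g g′ →
                                 HasCardinality Top 2 ⊎ HasCardinality Top 3
      alternatives⇒cardinality g≉g′ (inj₁ (_ , tops , _)) = inj₁
        ( g ∷ g′ ∷ [] , (g≉g′ ∷ []) ∷ [] ∷ [] , ≡.refl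
        , λ x → mk⇔
            ([ here , there ∘ here ]′ ∘ Equivalence.to (tops x))
            λ { (here x≈g)          → Equivalence.from (tops x) (inj₁ x≈g)
              ; (there (here x≈g′)) → Equivalence.from (tops x) (inj₂ x≈g′)
              ; (there (there ())) })
      alternatives⇒cardinality g≉g′ (inj₂ (_ , (γ , γ≉g , γ≉g′ , tops , _) , _)) = inj₂
        ( g ∷ g′ ∷ γ ∷ []
        , (g≉g′ ∷ (γ≉g ∘ ≈ᴹ-sym) ∷ []) ∷ ((γ≉g′ ∘ ≈ᴹ-sym) ∷ []) ∷ [] ∷ [] , ≡.refl
        , λ x → mk⇔
            ([ here , [ there ∘ here , there ∘ there ∘ here ]′ ]′ ∘ Equivalence.to (tops x))
            λ { (here x≈g)                 → Equivalence.from (tops x) (inj₁ x≈g)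
              ; (there (here x≈g′))        → Equivalence.from (tops x) (inj₂ (inj₁ x≈g′))
              ; (there (there (here x≈γ))) → Equivalence.from (tops x) (inj₂ (inj₂ x≈γ))
              ; (there (there (there ()))) })

    -- The functional `g -ᴹ g′` supports `F` at `g`: from `g` to the point with weight `t` at `g′`
    -- it drops by `t * ⟨ β , β ⟩`, which vanishes only for `t ≈ 0#`.
    end-vertex : ∀ {g g′} → Ends g g′ → IsVertex F g
    end-vertex {g} {g′} ends =
      β , ⟨ β , g ⟩ , -ᴹ-nonzero g≉g′ ,
      (λ x Fx → ≤-respˡ (⟨⟩-sym x β) (≤-respʳ (⟨⟩-sym g β) (face-≤ bounded Fx))) ,
      λ x → mk⇔ (λ x≈g → F-resp (≈ᴹ-sym x≈g) (proj₁ top) , ⟨⟩-congʳ β x≈g)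
                (λ (Fx , βx≈βg) → face-unique-max bounded unique Fx
                  (trans (⟨⟩-sym x β) (trans βx≈βg (⟨⟩-sym β g))))
      where
      open Ends ends
      β = g -ᴹ g′
      drop : ∀ {s t y} → s + t ≈ 1# → y ≈ᴹ s *ₗ g +ᴹ t *ₗ g′ →
             ⟨ g , β ⟩ - ⟨ y , β ⟩ ≈ t * ⟨ β , β ⟩
      drop {s} {t} {y} s+t≈1 y≈ = trans (sym (⟨⟩--ˡ g y β))
        (trans (⟨⟩-congˡ β (OnLine.left s+t≈1 y≈)) (⟨⟩-*ˡ t β β))
      bounded : ∀ {y} → Top y → ⟨ y , β ⟩ ≤ ⟨ g , β ⟩
      bounded y-top = let s , t , 0≤s , 0≤t , s+t≈1 , y≈ = segment y-top in
        0≤y-x⇒x≤y (≤-respʳ (sym (drop s+t≈1 y≈)) (*-nonNeg 0≤t (⟨⟩-nonNeg β)))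
      unique : ∀ {y} → Top y → ⟨ y , β ⟩ ≈ ⟨ g , β ⟩ → y ≈ᴹ g
      unique y-top yβ≈gβ = let s , t , 0≤s , 0≤t , s+t≈1 , y≈ = segment y-top in
        OnLine.t≈0⇒x≈g s+t≈1 y≈ (x*y≈0∧x≉0⇒y≈0
          (trans (*-comm _ t) (trans (sym (drop s+t≈1 y≈))
            (trans (+-congˡ (-‿cong yβ≈gβ)) (-‿inverseʳ _))))
          (<⇒≉ (⟨⟩-pos (-ᴹ-nonzero g≉g′)) ∘ sym))

    -- Both extreme roots are vertices, hence among `γ` and `γ′`; being distinct, they are these two
    -- in one order or the other.
    vertices-ends : ∀ {g g′ γ γ′} → Ends g g′ → AreTheVertices F γ γ′ → Ends γ γ′
    vertices-ends {g} {g′} {γ} {γ′} ends (_ , vertices) =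
      match (Equivalence.to (vertices g) (end-vertex ends))
            (Equivalence.to (vertices g′) (end-vertex (Ends-sym ends)))
      where
      open Ends ends
      match : g ≈ᴹ γ ⊎ g ≈ᴹ γ′ → g′ ≈ᴹ γ ⊎ g′ ≈ᴹ γ′ → Ends γ γ′
      match (inj₁ g≈γ)  (inj₂ g′≈γ′) = Ends-cong g≈γ g′≈γ′ ends
      match (inj₂ g≈γ′) (inj₁ g′≈γ)  = Ends-cong g′≈γ g≈γ′ (Ends-sym ends)
      match (inj₁ g≈γ)  (inj₁ g′≈γ)  = contradiction (≈ᴹ-trans g≈γ (≈ᴹ-sym g′≈γ)) g≉g′
      match (inj₂ g≈γ′) (inj₂ g′≈γ′) = contradiction (≈ᴹ-trans g≈γ′ (≈ᴹ-sym g′≈γ′)) g≉g′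

    -- Coordinates on the line through a one-dimensional face.

    module _ (dim : HasDimension F 1) where
      private
        p = proj₁ dim
        o = p zero
        u = p (suc zero) -ᴹ o

      base≉ : p zero ≉ᴹ p (suc zero)
      base≉ p₀≈p₁ = <⇒≉ 0<1 (sym (proj₁ (proj₂ (proj₂ dim)) a
        (solve 0 (con (+ 1) :+ ((:- con (+ 1)) :+ con (+ 0)) := con (+ 0)) refl)
        (⟨⟩-ext λ z → begin
          ⟨ linComb a p , z ⟩
            ≈⟨ ⟨⟩-linComb a p z ⟩
          1# * ⟨ p zero , z ⟩ + (- 1# * ⟨ p (suc zero) , z ⟩ + 0#)
            ≈⟨ +-congʳ (*-congˡ (⟨⟩-congˡ z p₀≈p₁)) ⟩
          1# * ⟨ p (suc zero) , z ⟩ + (- 1# * ⟨ p (suc zero) , z ⟩ + 0#)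
            ≈⟨ solve 1 (λ x → con (+ 1) :* x :+ ((:- con (+ 1)) :* x :+ con (+ 0)) := con (+ 0)) refl _ ⟩
          0#
            ≈⟨ ⟨⟩-0ˡ z ⟨
          ⟨ 0ᴹ , z ⟩ ∎) zero))
        where
        open ≈-Reasoning setoid
        a : Vector Carrier 2
        a zero    = 1#
        a (suc _) = - 1#

      coordinate : ∀ {x} → F x → ∃[ t ] (x ≈ᴹ o +ᴹ t *ₗ u)
      coordinate {x} Fx with proj₂ (proj₂ (proj₂ dim)) x Fx
      ... | a , ∑a≈1 , x≈ = a (suc zero) , ⟨⟩-ext λ z → begin
        ⟨ x , z ⟩
          ≈⟨ ⟨⟩-congˡ z x≈ ⟩
        ⟨ linComb a p , z ⟩
          ≈⟨ ⟨⟩-linComb a p z ⟩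
        a zero * ⟨ o , z ⟩ + (a (suc zero) * ⟨ p (suc zero) , z ⟩ + 0#)
          ≈⟨ solve 4 (λ a₀ a₁ p₀ p₁ → a₀ :* p₀ :+ (a₁ :* p₁ :+ con (+ 0)) :=
               (a₀ :+ (a₁ :+ con (+ 0))) :* p₀ :+ a₁ :* (p₁ :- p₀)) refl _ _ _ _ ⟩
        ∑ a * ⟨ o , z ⟩ + a (suc zero) * (⟨ p (suc zero) , z ⟩ - ⟨ o , z ⟩)
          ≈⟨ +-cong (trans (*-congʳ ∑a≈1) (*-identityˡ _)) (*-congˡ (sym (⟨⟩--ˡ _ o z))) ⟩
        ⟨ o , z ⟩ + a (suc zero) * ⟨ u , z ⟩
          ≈⟨ ⟨⟩-+*ˡ o _ u z ⟨
        ⟨ o +ᴹ a (suc zero) *ₗ u , z ⟩ ∎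
        where open ≈-Reasoning setoid

      -- Pairing with `u` is increasing in the coordinate, with slope `⟨ u , u ⟩`, positive because
      -- the two base points differ.
      coordinate-≤ : ∀ {x y s t} → x ≈ᴹ o +ᴹ s *ₗ u → y ≈ᴹ o +ᴹ t *ₗ u →
                     ⟨ x , u ⟩ ≤ ⟨ y , u ⟩ → s ≤ t
      coordinate-≤ {x} {y} {s} {t} x≈ y≈ xu≤yu =
        *-cancelˡ-≤ (⟨⟩-pos (-ᴹ-nonzero (base≉ ∘ ≈ᴹ-sym))) (≤-respˡ (*-comm s _) (≤-respʳ (*-comm t _)
          (0≤y-x⇒x≤y (≤-respʳ (begin
            ⟨ y , u ⟩ - ⟨ x , u ⟩
              ≈⟨ +-cong (pair y≈) (-‿cong (pair x≈)) ⟩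
            (⟨ o , u ⟩ + t * ⟨ u , u ⟩) - (⟨ o , u ⟩ + s * ⟨ u , u ⟩)
              ≈⟨ solve 3 (λ o s t → (o :+ t) :- (o :+ s) := t :- s) refl _ _ _ ⟩
            t * ⟨ u , u ⟩ - s * ⟨ u , u ⟩ ∎) (x≤y⇒0≤y-x xu≤yu)))))
        where
        open ≈-Reasoning setoid
        pair : ∀ {v k} → v ≈ᴹ o +ᴹ k *ₗ u → ⟨ v , u ⟩ ≈ ⟨ o , u ⟩ + k * ⟨ u , u ⟩
        pair v≈ = trans (⟨⟩-congˡ u v≈) (⟨⟩-+*ˡ o _ u u)

      ends-exist : ∃[ g ] ∃[ g′ ] Ends g g′
      ends-exist = g , g′ , record
        { top     = top
        ; top′    = top′
        ; g≉g′    = g≉g′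
        ; segment = λ {x} x-top →
            let t₁ , g≈  = coordinate (proj₁ top)
                t₀ , g′≈ = coordinate (proj₁ top′)
                t  , x≈  = coordinate (proj₁ x-top)
                t₀≤t = coordinate-≤ g′≈ x≈ (least x-top)
                t≤t₁ = coordinate-≤ x≈ g≈ (greatest x-top)
                t₀≉t₁ = λ t₀≈t₁ → g≉g′ (≈ᴹ-trans g≈ (≈ᴹ-trans
                          (+ᴹ-congˡ (*ₗ-congʳ (sym t₀≈t₁))) (≈ᴹ-sym g′≈)))
            in line-segment g≈ g′≈ x≈ (≤∧≉⇒< (≤.trans t₀≤t t≤t₁) t₀≉t₁) t₀≤t t≤t₁
        }
        where
        some-top = top-exists (proj₁ (proj₂ dim) zero)
        -- `argmax` and `argmin` take a default that competes with the list; choosing it among the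
        -- roots of `F` keeps both results in `F`.
        d = proj₁ some-top
        tops = filter Top? Φ
        height = λ x → ⟨ x , u ⟩
        g = argmax height d tops
        g′ = argmin height d tops
        top : Top g
        top = argmax-all height (proj₂ some-top) (all-filter Top? Φ)
        top′ : Top g′
        top′ = argmin-all height (proj₂ some-top) (all-filter Top? Φ)
        greatest : ∀ {x} → Top x → ⟨ x , u ⟩ ≤ ⟨ g , u ⟩
        greatest x-top = All.lookupₛ setoidᴹ (λ y≈z → ≤-respˡ (⟨⟩-congˡ u y≈z))
          (f[xs]≤f[argmax] d tops) (∈-filter⁺ setoidᴹ Top? Top-resp (proj₂ x-top) x-top)
        least : ∀ {x} → Top x → ⟨ g′ , u ⟩ ≤ ⟨ x , u ⟩
        least x-top = All.lookupₛ setoidᴹ (λ y≈z → ≤-respʳ (⟨⟩-congˡ u y≈z))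
          (f[argmin]≤f[xs] d tops) (∈-filter⁺ setoidᴹ Top? Top-resp (proj₂ x-top) x-top)
        -- If g ≈ g′, all roots of F, and hence all points of F, coincide.
        g≉g′ : g ≉ᴹ g′
        g≉g′ g≈g′ = base≉ (≈ᴹ-trans (point (proj₁ (proj₂ dim) zero))
                             (≈ᴹ-sym (point (proj₁ (proj₂ dim) (suc zero)))))
          where
          root≈g : ∀ {y} → Top y → y ≈ᴹ g
          root≈g y-top =
            let t₁ , g≈ = coordinate (proj₁ top)
                t  , y≈ = coordinate (proj₁ y-top)
                t≈t₁ = ≤.antisym (coordinate-≤ y≈ g≈ (greatest y-top))
                  (coordinate-≤ g≈ y≈ (≤-respˡ (⟨⟩-congˡ u (≈ᴹ-sym g≈g′)) (least y-top)))
            in ≈ᴹ-trans y≈ (≈ᴹ-trans (+ᴹ-congˡ (*ₗ-congʳ t≈t₁)) (≈ᴹ-sym g≈))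
          point : ∀ {x} → F x → x ≈ᴹ g
          -- Against `w` every point of `F` attains the maximum `b`, so uniqueness for roots passes
          -- to all of `F`.
          point Fx = face-unique-max {w} {b} (≤-reflexive ∘ top-height)
            (λ y-top _ → root≈g y-top) Fx (proj₂ (face⇒ Fx))

corollary6p3 :
  ∀ {c ℓ m ℓm f} (ℝ : RealField c ℓ) (E : EuclideanSpace ℝ m ℓm) →
  let open RealField ℝ
      open EuclideanSpace E
      open Convexity E
      open RootSystems E
  in
  (Φ : List Carrierᴹ) →
  IsRootSystem Φ → Crystallographic Φ → Reduced Φ → Irreducible Φ →
  (F : Pred Carrierᴹ f) → IsFace (ConvexHull (_∈ Φ)) F → HasDimension F 1 →
  RootsFormString Φ F ×
  (HasCardinality (F ∩ (_∈ Φ)) 2 ⊎ HasCardinality (F ∩ (_∈ Φ)) 3) ×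
  (∀ γ γ′ → AreTheVertices F γ γ′ →
    ( ¬ (⟨ γ , γ′ ⟩ ≈ 0#)
    × (∀ x → (F ∩ (_∈ Φ)) x ⇔ (x ≈ᴹ γ ⊎ x ≈ᴹ γ′))
    × (γ -ᴹ γ′) ∈ Φ )
    ⊎
    ( ⟨ γ , γ′ ⟩ ≈ 0#
    × (∃[ γ″ ]
        ( γ″ ≉ᴹ γ × γ″ ≉ᴹ γ′
        × (∀ x → (F ∩ (_∈ Φ)) x ⇔ (x ≈ᴹ γ ⊎ x ≈ᴹ γ′ ⊎ x ≈ᴹ γ″))
        × IsShort Φ γ″
        × γ -ᴹ γ″ ≈ᴹ γ″ -ᴹ γ′
        × (γ -ᴹ γ″) ∈ Φ ))
    × (∃[ δ ] (δ ∈ Φ × γ -ᴹ γ′ ≈ᴹ (1# + 1#) *ₗ δ)) ))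
corollary6p3 ℝ E Φ rootSystem crystallographic reduced irreducible F face dim =
  let open Faces.Face E Φ rootSystem crystallographic reduced irreducible F face
      g , g′ , ends = ends-exist dim
      alternatives = ends⇒alternatives ends
      open Ends ends
  in alternatives⇒string top top′ alternatives ,
     alternatives⇒cardinality top top′ g≉g′ alternatives ,
     λ γ γ′ vertices → ends⇒alternatives (vertices-ends ends vertices)
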